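{- Let $G=(V,E)$ be a graph with maximum degree at most $\Delta$ that is equipped with a proper input vertex coloring with $m$ colors. Let $d$ and $k$ be integers with $0\leq d\leq \Delta-1$ and $1\leq k\leq X$, where $$X=4\cdot\frac{\Delta}{d+1}\cdot\Big\lceil\log_{\Delta/(d+1)}m\Big\rceil,$$ and suppose $m,\Delta,d,k$ are known to all vertices. Then there is a deterministic \textsf{CONGEST} algorithm that uses $R=\lceil X/k\rceil$ rounds and computes a vertex coloring with $C=X\cdot k$ colors such that (1) the subgraph of $G$ induced by each color class admits an orientation of its edges in which every vertex has outdegree at most $d$; (2) each color class can be partitioned into $R$ sets $P_1,\ldots,P_R$ such that the subgraph of $G$ induced by each $P_i$ has maximum degree at most $d$. Moreover, the orientation in (1) and the partition in (2) are computed by the algorithm within the same $R$ rounds (no additional rounds).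
   Context: The \textsf{CONGEST} model: the graph $G=(V,E)$ is the communication network; computation proceeds in synchronous rounds, in each of which every vertex can send one message of $O(\log n)$ bits to each of its neighbors ($n=|V|$), and local computation is free. Initially each vertex knows only its own color in the input coloring (and the stated global parameters); at the end each vertex must know its own output color (and, here, the orientation of its incident edges and the index of its part). A (proper) $m$-coloring is a map $V\to\{0,\ldots,m-1\}$ assigning different colors to adjacent vertices. The output coloring here is not required to be proper; its properties are exactly those listed in (1) and (2).
   Formalization: The number m of input colors is assumed polynomial in n (m ≤ n^a, the constant in O(log n) depending on a), since for unbounded m the claim fails with O(log n)-bit messages; the case d = Δ−1, where the logarithm has base 1 and X is undefined, is excluded, as is m = 0. -}

module Defs where

open import Data.Nat using (ℕ; zero; suc; _+_; _*_; _∸_; _^_; _≤_; _<_; _≡ᵇ_; _/_; NonZero)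
open import Data.Nat.Logarithm using (⌈log₂_⌉)
open import Data.Bool using (Bool; true; false; _∧_; not)
open import Data.Fin using (Fin)
open import Data.List using (List; length; filterᵇ; allFin)
open import Data.Product using (Σ; _×_; proj₁)
open import Relation.Binary.PropositionalEquality using (_≡_; _≢_)
open import Function.Definitions using (Injective)

-- Graphs, given with a port numbering (each vertex addresses its incident
-- edges through local ports 0 .. deg v - 1).  Simple, undirected, loopless.

record Graph : Set where
  field
    n      : ℕ
    deg    : Fin n → ℕ
    nbr    : (v : Fin n) → Fin (deg v) → Fin n
    nbr-inj : (v : Fin n) → Injective _≡_ _≡_ (nbr v)
    no-loop : (v : Fin n) (p : Fin (deg v)) → nbr v p ≢ v
    back    : (v : Fin n) (p : Fin (deg v)) → Fin (deg (nbr v p))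
    back-ok : (v : Fin n) (p : Fin (deg v)) → nbr (nbr v p) (back v p) ≡ v

open Graph public

MaxDegree≤ : Graph → ℕ → Set
MaxDegree≤ G Δ = (v : Fin (n G)) → deg G v ≤ Δ

Proper : (G : Graph) (m : ℕ) → (Fin (n G) → Fin m) → Set
Proper G m col = (v : Fin (n G)) (p : Fin (deg G v)) → col (nbr G v p) ≢ col v

-- Deterministic distributed algorithm (same code at every vertex).  A vertex
-- initially knows its degree (its incident edges / ports) and its input colour;
-- the global parameters are fixed before the algorithm is chosen.  Messages are
-- natural numbers (bit strings); local computation is arbitrary.
-- Output: colour, orientation of each incident edge (true = outgoing), part index.

record Algorithm (m : ℕ) : Set₁ where
  field
    State   : ℕ → Set
    init    : (δ : ℕ) → Fin m → State δ
    send    : (δ : ℕ) → State δ → Fin δ → ℕ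
    receive : (δ : ℕ) → State δ → (Fin δ → ℕ) → State δ
    outColor  : (δ : ℕ) → State δ → ℕ
    outOrient : (δ : ℕ) → State δ → Fin δ → Bool
    outPart   : (δ : ℕ) → State δ → ℕ

open Algorithm public

run : {m : ℕ} (A : Algorithm m) (G : Graph) (col : Fin (n G) → Fin m) →
      ℕ → (v : Fin (n G)) → State A (deg G v)
run A G col zero    v = init A (deg G v) (col v)
run A G col (suc r) v =
  receive A (deg G v) (run A G col r v)
    (λ p → send A (deg G (nbr G v p)) (run A G col r (nbr G v p)) (back G v p))

MessagesFit : {m : ℕ} (A : Algorithm m) (G : Graph) (col : Fin (n G) → Fin m) →
              (R B : ℕ) → Set
MessagesFit A G col R B =
  (r : ℕ) → r < R → (v : Fin (n G)) (p : Fin (deg G v)) →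
  send A (deg G v) (run A G col r v) p < 2 ^ B

module _ {m : ℕ} (A : Algorithm m) (G : Graph) (col : Fin (n G) → Fin m) (R : ℕ) where

  color : Fin (n G) → ℕ
  color v = outColor A (deg G v) (run A G col R v)

  orient : (v : Fin (n G)) → Fin (deg G v) → Bool
  orient v = outOrient A (deg G v) (run A G col R v)

  part : Fin (n G) → ℕ
  part v = outPart A (deg G v) (run A G col R v)

  sameClass : (v : Fin (n G)) → Fin (deg G v) → Bool
  sameClass v p = color (nbr G v p) ≡ᵇ color v

  outdegInClass : Fin (n G) → ℕ
  outdegInClass v = length (filterᵇ (λ p → sameClass v p ∧ orient v p) (allFin (deg G v)))

  degInPart : Fin (n G) → ℕ
  degInPart v = length (filterᵇ (λ p → sameClass v p ∧ (part (nbr G v p) ≡ᵇ part v))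
                                (allFin (deg G v)))

  OrientationConsistent : Set
  OrientationConsistent = (v : Fin (n G)) (p : Fin (deg G v)) →
    color (nbr G v p) ≡ color v →
    orient (nbr G v p) (back G v p) ≡ not (orient v p)

-- Arithmetic of the parameters.  With b = Δ/(d+1) > 1:
-- t = ⌈log_b m⌉ is the least t with m ≤ b^t, i.e. m·(d+1)^t ≤ Δ^t.
IsCeilLog : (Δ d m t : ℕ) → Set
IsCeilLog Δ d m t = (m * (suc d) ^ t ≤ Δ ^ t)
                  × ((s : ℕ) → m * (suc d) ^ s ≤ Δ ^ s → t ≤ s)

-- X = 4·Δ·t/(d+1) (a rational); we use its numerator 4Δt over denominator d+1.
Xnum : (Δ t : ℕ) → ℕ
Xnum Δ t = 4 * Δ * t

-- ceiling division ⌈a / b⌉ (only used with b > 0; value for b = 0 irrelevant)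
cdiv : ℕ → ℕ → ℕ
cdiv a zero    = zero
cdiv a (suc b) = (a + b) / suc b

Rounds : (Δ d t k : ℕ) → ℕ
Rounds Δ d t k = cdiv (Xnum Δ t) (k * suc d)

{-# OPTIONS --safe #-}

-- Let q be a prime with 2tΔ/(d+1) < q ≤ 4tΔ/(d+1), which exists by Bertrand's
-- postulate.  Since m ≤ q ^ t, the input colours are encoded by distinct monic
-- polynomials of degree t over ℤ/q.  A vertex with polynomial f walks through
-- the positions x = 0 , 1 , 2 , …  at k per round and adopts the first position at
-- which the colour (x mod k , f(x)) clashes with at most d neighbours.  A
-- neighbour clashes at most t times while it is uncoloured (two polynomials
-- agree) and at most t times afterwards (one polynomial repeats a value), so
-- 2tΔ < q (d+1) leaves some position below q unblocked.  Orienting edges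
-- towards the smaller position, ties broken by input colour, every out-neighbour
-- is one of the at most d clashes, and the parts are the rounds of adoption.
--
-- Only the input colour and the adopted position are sent.  By the same count a
-- position is at most 2t·deg/(d+1), and t ≤ (d+1)m by Bernoulli's inequality,
-- so it is polynomial in n even when Δ is not.
module Submission where

open import Defs
open import Data.Nat
open import Data.Nat.Properties
open import Data.Nat.Combinatorics using (_C_; nCk≡n!/k![n-k]!; k![n∸k]!∣n!)
open import Data.Nat.Divisibility
open import Data.Nat.DivMod
open import Data.Nat.Induction using (<-rec)
open import Data.Nat.ListAction using (sum; product)
open import Data.Nat.Logarithm using (⌈log₂_⌉; ⌈log₂⌉-mono-≤; ⌈log₂⌈n/2⌉⌉≡⌈log₂n⌉∸1)
open import Data.Nat.Primality
open import Data.Nat.Primality.Factorisation using (factorise)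
open import Data.Nat.Tactic.RingSolver using (solve-∀)
import Data.Integer as ℤ
open ℤ using (ℤ; +_; 0ℤ)
import Data.Integer.Properties as ℤₚ
import Data.Integer.Divisibility.Signed as ℤ∣
open ℤ∣ using () renaming (_∣_ to _∣ℤ_)
open import Data.Integer.Tactic.RingSolver using () renaming (solve-∀ to solveℤ-∀)
open import Data.Bool using (Bool; true; false; T; T?; not; _∧_; _∨_)
open import Data.Bool.Properties using (T-∧)
open import Data.Unit using (tt)
open import Data.Empty using (⊥-elim)
open import Data.Product using (Σ; _×_; _,_; proj₁; proj₂; ∃-syntax)
open import Data.Sum as Sum using (_⊎_; inj₁; inj₂; [_,_]′; reduce)
open import Data.Fin using (Fin; toℕ)
open import Data.Fin.Properties using (toℕ<n; toℕ-injective; injective⇒≤)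
open import Data.Vec using (Vec; []; _∷_; zipWith)
import Data.Vec.Relation.Unary.All as VAll
open import Data.List using (List; []; _∷_; length; map; filterᵇ; upTo; allFin)
open import Data.List.Properties using (length-upTo; length-tabulate)
open import Data.List.Relation.Unary.All as All using (All; []; _∷_)
import Data.List.Relation.Unary.All.Properties as Allₚ
open import Data.List.Relation.Unary.AllPairs using ([]; _∷_)
open import Data.List.Relation.Unary.Unique.Propositional using (Unique)
import Data.List.Relation.Unary.Unique.Propositional.Properties as Unique
open import Function using (_∘_; it)
open import Function.Bundles using (Equivalence)
open import Relation.Binary.Definitions using (tri<; tri≈; tri>)
open import Relation.Binary.PropositionalEquality
open import Relation.Nullary
open import Relation.Nullary.Decidable using (True; toWitness; _×-dec_)

-- Binomial coefficients and primes

-- Indexed by the two parts rather than by their sum, so that the recurrences in either part are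
-- free of subtraction.
binom : ℕ → ℕ → ℕ
binom a b = (a + b) C a

binom-! : ∀ a b → binom a b * (a ! * b !) ≡ (a + b) !
binom-! a b = begin
  binom a b * (a ! * b !)                   ≡⟨ cong (λ z → binom a b * (a ! * z !)) (sym (m+n∸m≡n a b)) ⟩
  binom a b * (a ! * (a + b ∸ a) !)         ≡⟨ cong (_* (a ! * (a + b ∸ a) !)) (nCk≡n!/k![n-k]! (m≤m+n a b)) ⟩
  ((a + b) ! / (a ! * (a + b ∸ a) !)) * (a ! * (a + b ∸ a) !)
                                            ≡⟨ m/n*n≡m (k![n∸k]!∣n! (m≤m+n a b)) ⟩
  (a + b) !                                 ∎
  where
  open ≡-Reasoning
  instance _ = a !* (a + b ∸ a) !≢0

binom-sucˡ : ∀ a b → suc a * binom (suc a) b ≡ suc (a + b) * binom a b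
binom-sucˡ a b = *-cancelʳ-≡ _ _ (a ! * b !) (begin
  suc a * binom (suc a) b * (a ! * b !)     ≡⟨ lemma (suc a) (binom (suc a) b) (a !) (b !) ⟩
  binom (suc a) b * (suc a ! * b !)         ≡⟨ binom-! (suc a) b ⟩
  suc (a + b) * (a + b) !                   ≡⟨ cong (suc (a + b) *_) (sym (binom-! a b)) ⟩
  suc (a + b) * (binom a b * (a ! * b !))   ≡⟨ sym (*-assoc (suc (a + b)) (binom a b) _) ⟩
  suc (a + b) * binom a b * (a ! * b !)     ∎)
  where
  open ≡-Reasoning
  instance _ = a !* b !≢0
  lemma : ∀ s x u v → s * x * (u * v) ≡ x * (s * u * v)
  lemma = solve-∀

binom-sucʳ : ∀ a b → suc b * binom a (suc b) ≡ suc (a + b) * binom a b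
binom-sucʳ a b = *-cancelʳ-≡ _ _ (a ! * b !) (begin
  suc b * binom a (suc b) * (a ! * b !)     ≡⟨ lemma (suc b) (binom a (suc b)) (a !) (b !) ⟩
  binom a (suc b) * (a ! * suc b !)         ≡⟨ binom-! a (suc b) ⟩
  (a + suc b) !                             ≡⟨ cong _! (+-suc a b) ⟩
  suc (a + b) * (a + b) !                   ≡⟨ cong (suc (a + b) *_) (sym (binom-! a b)) ⟩
  suc (a + b) * (binom a b * (a ! * b !))   ≡⟨ sym (*-assoc (suc (a + b)) (binom a b) _) ⟩
  suc (a + b) * binom a b * (a ! * b !)     ∎)
  where
  open ≡-Reasoning
  instance _ = a !* b !≢0
  lemma : ∀ s x u v → s * x * (u * v) ≡ x * (u * (s * v))
  lemma = solve-∀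

binom-nonZero : ∀ a b → NonZero (binom a b)
binom-nonZero a b = m*n≢0⇒m≢0 (binom a b) {{subst NonZero (sym (binom-! a b)) ((a + b) !≢0)}}

central-step : ∀ n → binom (suc n) (suc n) ≡ 2 * binom n (suc n)
central-step n = *-cancelˡ-≡ _ _ (suc n) (begin
  suc n * binom (suc n) (suc n)             ≡⟨ binom-sucˡ n (suc n) ⟩
  suc (n + suc n) * binom n (suc n)         ≡⟨ lemma n (binom n (suc n)) ⟩
  suc n * (2 * binom n (suc n))             ∎)
  where
  open ≡-Reasoning
  lemma : ∀ n x → suc (n + suc n) * x ≡ suc n * (2 * x)
  lemma = solve-∀

-- Consecutive terms have ratio 2(2n+3)/(n+2), which is below 4.
odd-central-≤ : ∀ n → binom n (suc n) ≤ 4 ^ n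
odd-central-≤ zero    = ≤-refl
odd-central-≤ (suc n) = *-cancelˡ-≤ (suc (suc n)) (begin
  suc (suc n) * binom (suc n) (suc (suc n))       ≡⟨ binom-sucʳ (suc n) (suc n) ⟩
  suc (suc n + suc n) * binom (suc n) (suc n)     ≡⟨ cong (suc (suc n + suc n) *_) (central-step n) ⟩
  suc (suc n + suc n) * (2 * binom n (suc n))     ≤⟨ m≤m+n _ (2 * binom n (suc n)) ⟩
  suc (suc n + suc n) * (2 * binom n (suc n)) + 2 * binom n (suc n)
                                                  ≡⟨ lemma n (binom n (suc n)) ⟩
  suc (suc n) * (4 * binom n (suc n))             ≤⟨ *-monoʳ-≤ (suc (suc n)) (*-monoʳ-≤ 4 (odd-central-≤ n)) ⟩
  suc (suc n) * (4 * 4 ^ n)                       ∎)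
  where
  open ≤-Reasoning
  lemma : ∀ n x → suc (suc n + suc n) * (2 * x) + 2 * x ≡ suc (suc n) * (4 * x)
  lemma = solve-∀

-- From n to n+1 the right side grows by the factor 2(2n+3)/(n+1), which exceeds 4.
central-≥ : ∀ n → 4 ^ suc n ≤ 2 * suc n * binom (suc n) (suc n)
central-≥ zero    = ≤-refl
central-≥ (suc n) = begin
  4 * 4 ^ suc n                                   ≤⟨ *-monoʳ-≤ 4 (central-≥ n) ⟩
  4 * (2 * suc n * B)                             ≤⟨ m≤m+n _ (4 * B) ⟩
  4 * (2 * suc n * B) + 4 * B                     ≡⟨ lemma₁ n B ⟩
  4 * (suc (suc n + suc n) * B)                   ≡⟨ cong (4 *_) (sym (binom-sucʳ (suc n) (suc n))) ⟩
  4 * (suc (suc n) * binom (suc n) (suc (suc n))) ≡⟨ lemma₂ (suc (suc n)) (binom (suc n) (suc (suc n))) ⟩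
  2 * suc (suc n) * (2 * binom (suc n) (suc (suc n)))
                                                  ≡⟨ cong (2 * suc (suc n) *_) (sym (central-step (suc n))) ⟩
  2 * suc (suc n) * binom (suc (suc n)) (suc (suc n)) ∎
  where
  open ≤-Reasoning
  B = binom (suc n) (suc n)
  lemma₁ : ∀ n x → 4 * (2 * suc n * x) + 4 * x ≡ 4 * (suc (suc n + suc n) * x)
  lemma₁ = solve-∀
  lemma₂ : ∀ s x → 4 * (s * x) ≡ 2 * s * (2 * x)
  lemma₂ = solve-∀

-- The reciprocals of the entries suc (a + b) * binom a b form Leibniz's
-- harmonic triangle, 1/l(a,b) = 1/l(a+1,b) + 1/l(a,b+1), so divisibility
-- of L passes from two of them to the third.
leibniz-∣ : ∀ a b L → (∀ i → .{{NonZero i}} → i ≤ suc (a + b) → i ∣ L) → suc (a + b) * binom a b ∣ L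
leibniz-∣ zero    b L all = subst (_∣ L) (sym (*-identityʳ (suc b))) (all (suc b) ≤-refl)
leibniz-∣ (suc a) b L all
  with leibniz-∣ a b L (λ i i≤ → all i (m≤n⇒m≤1+n i≤))
     | leibniz-∣ a (suc b) L (λ i i≤ → all i (≤-trans i≤ (≤-reflexive (cong suc (+-suc a b)))))
-- With l the triangle entry, L/l(a+1,b) = L/l(a,b) - L/l(a,b+1), which is `w ∸ u`. Multiplication
-- distributes over truncated subtraction, so no comparison of w and u arises.
... | divides w L≡w | divides u L≡u = divides (w ∸ u) (*-cancelˡ-≡ _ _ (suc a) (sym (begin
  suc a * ((w ∸ u) * (s * binom (suc a) b))       ≡⟨ lemma₁ (suc a) (w ∸ u) s (binom (suc a) b) ⟩
  (w ∸ u) * (s * (suc a * binom (suc a) b))       ≡⟨ cong (λ z → (w ∸ u) * (s * z)) (binom-sucˡ a b) ⟩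
  (w ∸ u) * (s * D)                               ≡⟨ *-distribʳ-∸ (s * D) w u ⟩
  w * (s * D) ∸ u * (s * D)                       ≡⟨ cong₂ _∸_ eqw equ ⟩
  s * L ∸ suc b * L                               ≡⟨ sym (*-distribʳ-∸ L s (suc b)) ⟩
  (s ∸ suc b) * L                                 ≡⟨ cong (_* L) s∸ ⟩
  suc a * L                                       ∎)))
  where
  open ≡-Reasoning
  s = suc (suc a + b)
  D = suc (a + b) * binom a b
  lemma₁ : ∀ a w s x → a * (w * (s * x)) ≡ w * (s * (a * x))
  lemma₁ = solve-∀
  lemma₂ : ∀ w s x → w * (s * x) ≡ s * (w * x)
  lemma₂ = solve-∀
  eqw : w * (s * D) ≡ s * L
  eqw = trans (lemma₂ w s D) (cong (s *_) (sym L≡w))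
  equ : u * (s * D) ≡ suc b * L
  equ = begin
    u * (s * D)                                   ≡⟨ cong (λ z → u * (s * z)) (sym (binom-sucʳ a b)) ⟩
    u * (s * (suc b * binom a (suc b)))           ≡⟨ lemma₁' u s (suc b) (binom a (suc b)) ⟩
    suc b * (u * (s * binom a (suc b)))           ≡⟨ cong (λ z → suc b * (u * (suc z * binom a (suc b)))) (sym (+-suc a b)) ⟩
    suc b * (u * (suc (a + suc b) * binom a (suc b))) ≡⟨ cong (suc b *_) (sym L≡u) ⟩
    suc b * L                                     ∎
    where
    lemma₁' : ∀ u s b x → u * (s * (b * x)) ≡ b * (u * (s * x))
    lemma₁' = solve-∀
  s∸ : s ∸ suc b ≡ suc a
  s∸ = m+n∸n≡m (suc a) b

-- Prime powers dividing binomial coefficients and factorials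

1<prime : ∀ {p} → Prime p → 1 < p
1<prime {p} pp = nonTrivial⇒n>1 p {{prime⇒nonTrivial pp}}

prime∤* : ∀ {p} → Prime p → ∀ {a b} → p ∤ a → p ∤ b → p ∤ a * b
prime∤* pp {a} {b} p∤a p∤b = [ p∤a , p∤b ]′ ∘ euclidsLemma a b pp

prime∤small : ∀ {p} → ∀ i → .{{NonZero i}} → i < p → p ∤ i
prime∤small i i<p p∣i = <⇒≱ i<p (∣⇒≤ p∣i)

strip-prime : ∀ {p} → Prime p → ∀ N → .{{NonZero N}} →
              ∃[ e ] ∃[ N′ ] (N ≡ p ^ e * N′ × p ∤ N′)
strip-prime {p} pp N = <-rec P go N
  where
  P : ℕ → Set
  P N = .{{NonZero N}} → ∃[ e ] ∃[ N′ ] (N ≡ p ^ e * N′ × p ∤ N′)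
  instance
    _ = prime⇒nonZero pp
    _ = prime⇒nonTrivial pp
  go : ∀ N → (∀ {M} → M < N → P M) → P N
  go N rec with p ∣? N
  ... | no p∤N = 0 , N , sym (+-identityʳ N) , p∤N
  ... | yes p∣N with rec (quotient-< p∣N) {{quotient≢0 p∣N}}
  ...   | e , N′ , eq , p∤N′ = suc e , N′ , (begin
      N                       ≡⟨ m∣n⇒n≡m*quotient p∣N ⟩
      p * quotient p∣N        ≡⟨ cong (p *_) eq ⟩
      p * (p ^ e * N′)        ≡⟨ sym (*-assoc p (p ^ e) N′) ⟩
      p ^ suc e * N′          ∎) , p∤N′
    where open ≡-Reasoning

-- The multiple is p ^ e times the product of the p-free parts of 1 , … , n.
common-multiple : ∀ {p} → Prime p → ∀ e n → n < p ^ suc e →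
                  ∃[ K ] (p ∤ K × (∀ i → .{{NonZero i}} → i ≤ n → i ∣ p ^ e * K))
common-multiple {p} pp e zero _ = 1 , (λ p∣1 → <⇒≱ (1<prime pp) (∣⇒≤ p∣1)) ,
  λ i i≤0 → contradiction (n≤0⇒n≡0 i≤0) (≢-nonZero⁻¹ i)
common-multiple {p} pp e (suc n) n<
  with common-multiple pp e n (<-trans (n<1+n n) n<) | strip-prime pp (suc n)
... | K , p∤K , all | f , N′ , eq , p∤N′ = K * N′ , prime∤* pp p∤K p∤N′ , all′
  where
  instance _ = prime⇒nonZero pp
  f≤e : f ≤ e
  f≤e with f ≤? e
  ... | yes q = q
  ... | no  q = contradiction (∣⇒≤ (subst (p ^ f ∣_) (sym eq) (m∣m*n N′)))
                  (<⇒≱ (<-≤-trans n< (^-monoʳ-≤ p (≰⇒> q))))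
  all′ : ∀ i → .{{NonZero i}} → i ≤ suc n → i ∣ p ^ e * (K * N′)
  all′ i i≤ with m≤n⇒m<n∨m≡n i≤
  ... | inj₁ i<  = subst (i ∣_) (*-assoc (p ^ e) K N′) (∣m⇒∣m*n N′ (all i (≤-pred i<)))
  ... | inj₂ refl = subst₂ _∣_ (sym eq) (lemma (p ^ e) N′ K) (∣m⇒∣m*n K (*-monoˡ-∣ N′ p^f∣p^e))
    where
    lemma : ∀ a b c → a * b * c ≡ a * (c * b)
    lemma = solve-∀
    p^f∣p^e : p ^ f ∣ p ^ e
    p^f∣p^e = divides (p ^ (e ∸ f)) (trans (cong (p ^_) (sym (m∸n+n≡m f≤e))) (^-distribˡ-+-* p (e ∸ f) f))

-- Otherwise 1, ..., a+b+1 have a common multiple p^e · K with p ∤ K, where p^(e+1) is the given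
-- power. The triangle entry divides it, hence so does p^(e+1), which forces p ∣ K.
prime-power∣leibniz : ∀ {p} → Prime p → ∀ e a b → p ^ e ∣ suc (a + b) * binom a b → p ^ e ≤ suc (a + b)
prime-power∣leibniz pp zero a b _ = s≤s z≤n
prime-power∣leibniz {p} pp (suc e) a b p∣ with p ^ suc e ≤? suc (a + b)
... | yes q = q
... | no  q with common-multiple pp e (suc (a + b)) (≰⇒> q)
...   | K , p∤K , all = contradiction
        (*-cancelˡ-∣ (p ^ e) (subst (_∣ p ^ e * K) (*-comm p (p ^ e)) (∣-trans p∣ (leibniz-∣ a b (p ^ e * K) all))))
        p∤K
  where instance
    _ = prime⇒nonZero pp
    _ = m^n≢0 p e

-- For n = a+1, n · C(2n,n) is the entry of Leibniz's triangle at (a, a+1), where the bound on prime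
-- powers is exactly 2n.
prime-power∣central : ∀ {p} → Prime p → ∀ e n → .{{NonZero n}} → p ^ e ∣ binom n n → p ^ e ≤ 2 * n
prime-power∣central {p} pp e (suc a) p∣ = subst (p ^ e ≤_) (cong (_+_ (suc a)) (sym (+-identityʳ (suc a))))
  (prime-power∣leibniz pp e a (suc a) (subst (p ^ e ∣_) (binom-sucˡ a (suc a)) (∣n⇒∣m*n (suc a) p∣)))

prime-factor-! : ∀ {p} → Prime p → ∀ n → p ∣ n ! → p ≤ n
prime-factor-! pp zero    p∣ = contradiction (∣⇒≤ p∣) (<⇒≱ (1<prime pp))
prime-factor-! pp (suc n) p∣ with euclidsLemma (suc n) (n !) pp p∣
... | inj₁ p∣s = ∣⇒≤ p∣s
... | inj₂ p∣! = m≤n⇒m≤1+n (prime-factor-! pp n p∣!)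

-- The multiples of p up to qp+j are p, 2p, ..., qp. Since q < p, each contributes exactly one
-- factor p.
prime-part-! : ∀ {p} → Prime p → ∀ q j → q < p → j < p → ∃[ u ] ((q * p + j) ! ≡ p ^ q * u × p ∤ u)
prime-part-! {p@(suc p-1)} pp zero zero _ _ = 1 , refl , λ p∣1 → <⇒≱ (1<prime pp) (∣⇒≤ p∣1)
prime-part-! {p@(suc p-1)} pp (suc q) zero q<p _
  with prime-part-! pp q p-1 (<-trans (n<1+n q) q<p) (n<1+n p-1)
... | u , eq , p∤u = suc q * u , (begin
    (suc q * p + 0) !               ≡⟨ cong _! (lemma₁ q p-1) ⟩
    suc (q * p + p-1) * (q * p + p-1) ! ≡⟨ cong (suc (q * p + p-1) *_) eq ⟩
    suc (q * p + p-1) * (p ^ q * u) ≡⟨ cong (_* (p ^ q * u)) (lemma₂ q p-1) ⟩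
    suc q * p * (p ^ q * u)         ≡⟨ lemma₃ (suc q) p (p ^ q) u ⟩
    p ^ suc q * (suc q * u)         ∎) , prime∤* pp (prime∤small (suc q) q<p) p∤u
  where
  open ≡-Reasoning
  lemma₁ : ∀ q r → suc q * suc r + 0 ≡ suc (q * suc r + r)
  lemma₁ = solve-∀
  lemma₂ : ∀ q r → suc (q * suc r + r) ≡ suc q * suc r
  lemma₂ = solve-∀
  lemma₃ : ∀ s p x u → s * p * (x * u) ≡ p * x * (s * u)
  lemma₃ = solve-∀
prime-part-! {p} pp q (suc j) q<p j<p
  with prime-part-! pp q j q<p (<-trans (n<1+n j) j<p)
... | u , eq , p∤u = suc (q * p + j) * u , (begin
    (q * p + suc j) !               ≡⟨ cong _! (+-suc (q * p) j) ⟩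
    suc (q * p + j) * (q * p + j) ! ≡⟨ cong (suc (q * p + j) *_) eq ⟩
    suc (q * p + j) * (p ^ q * u)   ≡⟨ lemma (suc (q * p + j)) (p ^ q) u ⟩
    p ^ q * (suc (q * p + j) * u)   ∎) , prime∤* pp p∤s p∤u
  where
  open ≡-Reasoning
  lemma : ∀ s x u → s * (x * u) ≡ x * (s * u)
  lemma = solve-∀
  p∤s : p ∤ suc (q * p + j)
  p∤s p∣ = prime∤small (suc j) j<p (∣m+n∣m⇒∣n (subst (p ∣_) (sym (+-suc (q * p) j)) p∣) (n∣m*n q))

-- p divides n ! exactly once and (2 n) ! exactly twice.
prime∤central : ∀ {p} → Prime p → 2 < p → ∀ n → p ≤ n → 2 * n < 3 * p → p ∤ binom n n
prime∤central {p} pp 2<p n p≤n 2n<3p p∣C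
  with m≤n⇒∃[o]m+o≡n p≤n
... | s , refl
  with prime-part-! pp 1 s (<-trans (n<1+n 1) 2<p) s<p | prime-part-! pp 2 (2 * s) 2<p 2s<p
  where
  2s<p : 2 * s < p
  2s<p = +-cancelˡ-< (2 * p) (2 * s) p (subst₂ _<_ (*-distribˡ-+ 2 p s) (lemma p) 2n<3p)
    where
    lemma : ∀ p → 3 * p ≡ 2 * p + p
    lemma = solve-∀
  s<p : s < p
  s<p = ≤-<-trans (m≤n*m s 2) 2s<p
... | u , eqᵤ , p∤u | w , eqw , p∤w = p∤w (subst (p ∣_) eq (∣m⇒∣m*n (u * u) p∣C))
  where
  open ≡-Reasoning
  instance
    _ = prime⇒nonZero pp
    _ = m^n≢0 p 2
  eq : binom (p + s) (p + s) * (u * u) ≡ w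
  eq = *-cancelˡ-≡ _ _ (p ^ 2) (begin
    p ^ 2 * (binom (p + s) (p + s) * (u * u))         ≡⟨ lemma₁ p (binom (p + s) (p + s)) u ⟩
    binom (p + s) (p + s) * (p ^ 1 * u * (p ^ 1 * u)) ≡⟨ cong (λ z → binom (p + s) (p + s) * (z * z)) (sym eqᵤ) ⟩
    binom (p + s) (p + s) * ((1 * p + s) ! * (1 * p + s) !)
                                                      ≡⟨ cong (λ z → binom (p + s) (p + s) * ((z + s) ! * (z + s) !)) (+-identityʳ p) ⟩
    binom (p + s) (p + s) * ((p + s) ! * (p + s) !)   ≡⟨ binom-! (p + s) (p + s) ⟩
    (p + s + (p + s)) !                               ≡⟨ cong _! (lemma₂ p s) ⟩
    (2 * p + 2 * s) !                                 ≡⟨ eqw ⟩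
    p ^ 2 * w                                         ∎)
    where
    lemma₁ : ∀ p c u → p * (p * 1) * (c * (u * u)) ≡ c * (p * 1 * u * (p * 1 * u))
    lemma₁ = solve-∀
    lemma₂ : ∀ p s → p + s + (p + s) ≡ 2 * p + 2 * s
    lemma₂ = solve-∀

-- Bertrand's postulate

^-distribʳ-* : ∀ n a b → (a * b) ^ n ≡ a ^ n * b ^ n
^-distribʳ-* zero    a b = refl
^-distribʳ-* (suc n) a b = trans (cong (a * b *_) (^-distribʳ-* n a b)) (lemma a b (a ^ n) (b ^ n))
  where
  lemma : ∀ a b c d → a * b * (c * d) ≡ a * c * (b * d)
  lemma = solve-∀

m/o<n⇒m<n*o : ∀ {m n o} .{{_ : NonZero o}} → m / o < n → m < n * o
m/o<n⇒m<n*o {m} {n} {o} m/o<n with m <? n * o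
... | yes z = z
... | no  z = contradiction (subst (_≤ m / o) (m*n/n≡m n o) (/-monoˡ-≤ o (≮⇒≥ z))) (<⇒≱ m/o<n)

Π : (ℕ → ℕ) → ℕ → ℕ
Π g zero    = 1
Π g (suc M) = g (suc M) * Π g M

Π-* : ∀ f g M → Π (λ i → f i * g i) M ≡ Π f M * Π g M
Π-* f g zero    = refl
Π-* f g (suc M) = trans (cong (f (suc M) * g (suc M) *_) (Π-* f g M)) (lemma (f (suc M)) (g (suc M)) (Π f M) (Π g M))
  where
  lemma : ∀ a b c d → a * b * (c * d) ≡ a * c * (b * d)
  lemma = solve-∀

primeOr1 : ℕ → ℕ
primeOr1 i with prime? i
... | yes _ = i
... | no  _ = 1

primorial : ℕ → ℕ
primorial = Π primeOr1

-- Induction on M: if M is prime, its full power is split off N and bounded by g M, and the cofactor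
-- has only smaller prime factors. At M = 0 no prime factor is left, so N = 1.
≤-prime-powers : ∀ g → (∀ i → .{{NonZero i}} → 1 ≤ g i) → ∀ M N → .{{NonZero N}} →
                 (∀ {p} → Prime p → p ∣ N → p ≤ M) →
                 (∀ {p} → Prime p → ∀ e → p ^ e ∣ N → p ^ e ≤ g p) → N ≤ Π g M
≤-prime-powers g 1≤g zero    N small pow with factorise N
... | record { factors = []    ; isFactorisation = eq } = ≤-reflexive eq
... | record { factors = p ∷ ps ; isFactorisation = eq ; factorsPrime = pp ∷ _ } =
  contradiction (small pp (subst (p ∣_) (sym eq) (m∣m*n (product ps)))) (<⇒≱ (<-trans z<s (1<prime pp)))
≤-prime-powers g 1≤g (suc M) N small pow with prime? (suc M)
... | no ¬pp = ≤-trans (≤-prime-powers g 1≤g M N small′ pow)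
                 (subst (_≤ g (suc M) * Π g M) (*-identityˡ (Π g M)) (*-monoˡ-≤ (Π g M) (1≤g (suc M))))
  where
  small′ : ∀ {p} → Prime p → p ∣ N → p ≤ M
  small′ pp p∣N = ≤-pred (≤∧≢⇒< (small pp p∣N) λ { refl → ¬pp pp })
... | yes pp with strip-prime pp N
...   | e , N′ , eq , p∤N′ = subst (_≤ g (suc M) * Π g M) (sym eq)
          (*-mono-≤ (pow pp e (subst (suc M ^ e ∣_) (sym eq) (m∣m*n N′)))
                    (≤-prime-powers g 1≤g M N′ small′ (λ pp e p∣ → pow pp e (∣-trans p∣ N′∣N))))
  where
  N′∣N : N′ ∣ N
  N′∣N = subst (N′ ∣_) (sym eq) (n∣m*n (suc M ^ e))
  instance _ = m*n≢0⇒n≢0 (suc M ^ e) {{subst NonZero eq it}}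
  small′ : ∀ {p} → Prime p → p ∣ N′ → p ≤ M
  small′ pp p∣N = ≤-pred (≤∧≢⇒< (small pp (∣-trans p∣N N′∣N)) λ { refl → p∤N′ p∣N })

Π-+ : ∀ g a j → Π g (a + j) ≡ Π g a * Π (g ∘ (_+_ a)) j
Π-+ g a zero    = trans (cong (Π g) (+-identityʳ a)) (sym (*-identityʳ (Π g a)))
Π-+ g a (suc j) = begin
  Π g (a + suc j)                                     ≡⟨ cong (Π g) (+-suc a j) ⟩
  g (suc (a + j)) * Π g (a + j)                       ≡⟨ cong₂ _*_ (cong g (sym (+-suc a j))) (Π-+ g a j) ⟩
  g (a + suc j) * (Π g a * Π (g ∘ (_+_ a)) j)          ≡⟨ lemma (g (a + suc j)) (Π g a) _ ⟩
  Π g a * (g (a + suc j) * Π (g ∘ (_+_ a)) j)          ∎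
  where
  open ≡-Reasoning
  lemma : ∀ x y z → x * (y * z) ≡ y * (x * z)
  lemma = solve-∀

-- Once the largest prime q is divided out of N, every smaller prime p of the range still divides
-- the cofactor, by Euclid's lemma and p ∤ q.
primes-∣ : ∀ a j N → (∀ {p} → Prime p → a < p → p ≤ a + j → p ∣ N) → Π (primeOr1 ∘ (_+_ a)) j ∣ N
primes-∣ a zero    N all = 1∣ N
primes-∣ a (suc j) N all with prime? (a + suc j)
... | no  _  = subst (_∣ N) (sym (*-identityˡ _))
                 (primes-∣ a j N λ pp a<p p≤ → all pp a<p (≤-trans p≤ (+-monoʳ-≤ a (n≤1+n j))))
... | yes qq with all qq (m<m+n a z<s) ≤-refl
...   | divides N′ refl = subst (_∣ N′ * q) (*-comm _ q) (*-monoˡ-∣ q (primes-∣ a j N′ λ pp a<p p≤ →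
          [ (λ d → d) , (λ p∣q → contradiction p∣q (p∤q pp p≤)) ]′
            (euclidsLemma N′ q pp (all pp a<p (≤-trans p≤ (+-monoʳ-≤ a (n≤1+n j)))))))
  where
  q = a + suc j
  p∤q : ∀ {p} → Prime p → p ≤ a + j → p ∤ q
  p∤q pp p≤ p∣q with prime⇒irreducible qq p∣q
  ... | inj₁ refl = contradiction (1<prime pp) (<-irrefl refl)
  ... | inj₂ refl = <⇒≱ (+-monoʳ-< a (n<1+n j)) p≤

halves : ∀ n → ∃[ k ] (n ≡ k + k ⊎ n ≡ suc (k + k))
halves zero    = 0 , inj₁ refl
halves (suc n) with halves n
... | k , inj₁ eq = k , inj₂ (cong suc eq)
... | k , inj₂ eq = suc k , inj₁ (cong suc (trans eq (sym (+-suc k k))))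

-- Erdős's induction. An even n > 2 contributes no prime. For n = 2m+1 with m ≥ 1, the primes in
-- (m+1, 2m+1] divide (2m+1)! but neither m! nor (m+1)!, so their product divides C(2m+1,m) ≤ 4^m.
primorial-≤ : ∀ n → primorial n ≤ 4 ^ n
primorial-≤ = <-rec _ go
  where
  open ≤-Reasoning
  go : ∀ n → (∀ {m} → m < n → primorial m ≤ 4 ^ m) → primorial n ≤ 4 ^ n
  go n rec with halves n
  ... | 0 , inj₁ refl = ≤-refl
  ... | 1 , inj₁ refl = s≤s (s≤s z≤n)
  ... | suc (suc k) , inj₁ refl with prime? n
  ...   | yes pp = [ (λ ()) , (λ 2≡n → contradiction (subst (3 ≤_) (sym 2≡n) (s≤s (s≤s (m≤n⇒m≤o+n k (s≤s z≤n))))) λ { (s≤s (s≤s ())) }) ]′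
              (prime⇒irreducible pp {2} (divides (2 + k) (lemma (2 + k))))
    where
    lemma : ∀ k → k + k ≡ k * 2
    lemma = solve-∀
  ...   | no  _  = begin
    1 * primorial m         ≡⟨ *-identityˡ (primorial m) ⟩
    primorial m             ≤⟨ rec ≤-refl ⟩
    4 ^ m                   ≤⟨ m≤n*m (4 ^ m) 4 ⟩
    4 ^ suc m               ∎
    where m = suc (k + suc (suc k))
  go n rec | 0 , inj₂ refl = s≤s z≤n
  go n rec | suc k , inj₂ refl = begin
    primorial (suc m + m)                                   ≡⟨ Π-+ primeOr1 (suc m) m ⟩
    primorial (suc m) * Π (primeOr1 ∘ (_+_ (suc m))) m         ≤⟨ *-mono-≤ (rec (m<m+n (suc m) z<s)) (≤-trans (∣⇒≤ ∣binom) (odd-central-≤ m)) ⟩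
    4 ^ suc m * 4 ^ m                                       ≡⟨ sym (^-distribˡ-+-* 4 (suc m) m) ⟩
    4 ^ (suc m + m)                                         ∎
    where
    m = suc k
    instance _ = binom-nonZero m (suc m)
    ∣binom : Π (primeOr1 ∘ (_+_ (suc m))) m ∣ binom m (suc m)
    ∣binom = primes-∣ (suc m) m (binom m (suc m)) λ {p} pp m<p p≤ →
      [ (λ d → d)
      , (λ d → contradiction d (prime∤* pp (λ d → <⇒≱ m<p (m≤n⇒m≤1+n (prime-factor-! pp m d)))
                                           (λ d → <⇒≱ m<p (prime-factor-! pp (suc m) d)))) ]′
      (euclidsLemma (binom m (suc m)) (m ! * suc m !) pp
        (subst (p ∣_) (sym (binom-! m (suc m))) (∣-trans (p∣! p {{prime⇒nonZero pp}})
           (m≤n⇒m!∣n! (≤-trans p≤ (≤-reflexive (sym (+-suc m m))))))))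
      where
      p∣! : ∀ p → .{{NonZero p}} → p ∣ p !
      p∣! (suc p) = m∣m*n (p !)

isqrt : ∀ x → ∃[ r ] (r * r ≤ x × x < suc r * suc r)
isqrt zero    = 0 , z≤n , s≤s z≤n
isqrt (suc x) with isqrt x
... | r , lo , hi with suc r * suc r ≤? suc x
...   | yes q = suc r , q , ≤-<-trans hi (*-mono-< (n<1+n (suc r)) (n<1+n (suc r)))
...   | no  q = r , m≤n⇒m≤1+n lo , ≰⇒> q

sixth-power-≤ : ∀ a b x y → .{{NonZero a}} → a * x ≤ b * y → b ^ 6 ≤ 2 * a ^ 6 → x ^ 6 ≤ 2 * y ^ 6
sixth-power-≤ a b x y ax≤by b⁶≤2a⁶ = *-cancelˡ-≤ (a ^ 6) {{m^n≢0 a 6}} (begin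
  a ^ 6 * x ^ 6             ≡⟨ sym (^-distribʳ-* 6 a x) ⟩
  (a * x) ^ 6               ≤⟨ ^-monoˡ-≤ 6 ax≤by ⟩
  (b * y) ^ 6               ≡⟨ ^-distribʳ-* 6 b y ⟩
  b ^ 6 * y ^ 6             ≤⟨ *-monoˡ-≤ (y ^ 6) b⁶≤2a⁶ ⟩
  2 * a ^ 6 * y ^ 6         ≡⟨ lemma (a ^ 6) (y ^ 6) ⟩
  a ^ 6 * (2 * y ^ 6)       ∎)
  where
  open ≤-Reasoning
  lemma : ∀ u v → 2 * u * v ≡ u * (2 * v)
  lemma = solve-∀

-- From r = 30 on, one step multiplies the left side by at most (10/9)^6 < 2.
sixth-power≤2^ : ∀ {r} → 30 ≤ r → suc r ^ 6 ≤ 2 ^ r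
sixth-power≤2^ = go ∘ ≤⇒≤′
  where
  lemma : ∀ j → 9 * (10 + j) + j ≡ 10 * (9 + j)
  lemma = solve-∀
  9/10 : ∀ {r} → 8 ≤ r → 9 * suc (suc r) ≤ 10 * suc r
  9/10 8≤r with m≤n⇒∃[o]m+o≡n 8≤r
  ... | j , refl = subst (9 * (10 + j) ≤_) (lemma j) (m≤m+n (9 * (10 + j)) j)
  go : ∀ {r} → 30 ≤′ r → suc r ^ 6 ≤ 2 ^ r
  go ≤′-refl            = ≤ᵇ⇒≤ (31 ^ 6) (2 ^ 30) _
  go (≤′-step {r} 30≤r) = ≤-trans
    (sixth-power-≤ 9 10 (suc (suc r)) (suc r) (9/10 (≤-trans (m≤m+n 8 22) (≤′⇒≤ 30≤r))) (≤ᵇ⇒≤ (10 ^ 6) (2 * 9 ^ 6) _))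
    (*-monoʳ-≤ 2 (go 30≤r))

-- Allows for the powers of primes up to r. Index 1 gets the value 1, which leaves at most r - 1
-- factors W in a product; the spared one absorbs the factor 2n of `central-≥`.
smallFactor : ℕ → ℕ → ℕ → ℕ
smallFactor W r i with 1 <? i | i ≤? r
... | yes _ | yes _ = W
... | _     | _     = 1

module _ (W : ℕ) .{{_ : NonZero W}} (r : ℕ) where

  smallFactor≤ : ∀ i → smallFactor W r i ≤ W
  smallFactor≤ i with 1 <? i | i ≤? r
  ... | yes _ | yes _ = ≤-refl
  ... | yes _ | no  _ = >-nonZero⁻¹ W
  ... | no  _ | _     = >-nonZero⁻¹ W

  smallFactor≥1 : ∀ i → 1 ≤ smallFactor W r i
  smallFactor≥1 i with 1 <? i | i ≤? r
  ... | yes _ | yes _ = >-nonZero⁻¹ W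
  ... | yes _ | no  _ = ≤-refl
  ... | no  _ | _     = ≤-refl

  smallFactor-out : ∀ {i} → r < i → smallFactor W r i ≡ 1
  smallFactor-out {i} r<i with 1 <? i | i ≤? r
  ... | yes _ | yes q = contradiction q (<⇒≱ r<i)
  ... | yes _ | no  _ = refl
  ... | no  _ | _     = refl

  smallFactor-in : ∀ {i} → 1 < i → i ≤ r → smallFactor W r i ≡ W
  smallFactor-in {i} 1<i i≤r with 1 <? i | i ≤? r
  ... | yes _ | yes _ = refl
  ... | yes _ | no  q = contradiction i≤r q
  ... | no q  | _     = contradiction 1<i q

  Π-smallFactor₀ : ∀ M → Π (smallFactor W r) M ≤ W ^ pred M
  Π-smallFactor₀ zero          = ≤-refl
  Π-smallFactor₀ (suc zero)    = ≤-refl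
  Π-smallFactor₀ (suc (suc M)) = *-mono-≤ (smallFactor≤ (suc (suc M))) (Π-smallFactor₀ (suc M))

  Π-smallFactor : ∀ M → Π (smallFactor W r) M ≤ W ^ pred r
  Π-smallFactor M with M ≤? r
  ... | yes M≤r = ≤-trans (Π-smallFactor₀ M) (^-monoʳ-≤ W (pred-mono-≤ M≤r))
  Π-smallFactor zero    | no M≰r = contradiction z≤n M≰r
  Π-smallFactor (suc M) | no M≰r = begin
    smallFactor W r (suc M) * Π (smallFactor W r) M ≡⟨ cong (_* Π (smallFactor W r) M) (smallFactor-out (≰⇒> M≰r)) ⟩
    1 * Π (smallFactor W r) M                       ≡⟨ *-identityˡ _ ⟩
    Π (smallFactor W r) M                           ≤⟨ Π-smallFactor M ⟩
    W ^ pred r                                      ∎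
    where open ≤-Reasoning

primeOr1≥1 : ∀ i → .{{NonZero i}} → 1 ≤ primeOr1 i
primeOr1≥1 i with prime? i
... | yes _ = >-nonZero⁻¹ i
... | no  _ = ≤-refl

primeOr1-prime : ∀ {p} → Prime p → primeOr1 p ≡ p
primeOr1-prime {p} pp with prime? p
... | yes _ = refl
... | no ¬p = contradiction pp ¬p

PrimeBetween : ℕ → Set
PrimeBetween n = ∃[ q ] (Prime q × n < q × q ≤ 2 * n)

primeBetween? : ∀ n → Dec (PrimeBetween n)
primeBetween? n with anyUpTo? (λ q → prime? q ×-dec (n <? q)) (suc (2 * n))
... | yes (q , q< , pq , n<q) = yes (q , pq , n<q , ≤-pred q<)
... | no  ¬q                  = no λ (q , pq , n<q , q≤) → ¬q (q , s≤s q≤ , pq , n<q)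

-- Without a prime in (n , 2 n] every prime factor of the central binomial
-- coefficient is at most M = ⌊2n/3⌋, and those above r = ⌊√(2n)⌋ occur once.
central-≤ : ∀ n → 2 < n → ¬ PrimeBetween n → ∀ r → 2 * n < suc r * suc r →
            binom n n ≤ (2 * n) ^ pred r * 4 ^ (2 * n / 3)
central-≤ n 2<n none r hi = begin
  binom n n                                 ≤⟨ ≤-prime-powers g 1≤g M (binom n n) small pow ⟩
  Π g M                                     ≡⟨ Π-* (smallFactor W r) primeOr1 M ⟩
  Π (smallFactor W r) M * primorial M       ≤⟨ *-mono-≤ (Π-smallFactor W r M) (primorial-≤ M) ⟩
  W ^ pred r * 4 ^ M                        ∎
  where
  open ≤-Reasoning
  W = 2 * n
  M = 2 * n / 3
  -- For p ≤ r the bound W · p is generous, W alone being enough; the surplus p makes the product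
  -- split into a power of W and a whole primorial.
  g : ℕ → ℕ
  g i = smallFactor W r i * primeOr1 i
  instance
    _ = binom-nonZero n n
    _ = >-nonZero (<-trans z<s 2<n)
    _ = m*n≢0 2 n
  1≤g : ∀ i → .{{NonZero i}} → 1 ≤ g i
  1≤g i = *-mono-≤ (smallFactor≥1 W r i) (primeOr1≥1 i)
  small : ∀ {p} → Prime p → p ∣ binom n n → p ≤ M
  small {p} pp p∣ with p ≤? M
  ... | yes q = q
  ... | no  q = contradiction p∣ (prime∤central pp 2<p n p≤n 2n<3p)
    where
    2n<3p : 2 * n < 3 * p
    2n<3p = subst (2 * n <_) (*-comm p 3) (m/o<n⇒m<n*o (≰⇒> q))
    p≤n : p ≤ n
    p≤n with p ≤? n
    ... | yes z = z
    ... | no  z = contradiction (p , pp , ≰⇒> z ,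
                    subst (_≤ 2 * n) (*-identityʳ p)
                      (prime-power∣central pp 1 n (subst (_∣ binom n n) (sym (*-identityʳ p)) p∣))) none
    2<p : 2 < p
    2<p with 2 <? p
    ... | yes z = z
    ... | no  z = contradiction 2n<3p (≤⇒≯ (≤-trans (*-monoʳ-≤ 3 (≮⇒≥ z)) (*-monoʳ-≤ 2 2<n)))
  pow : ∀ {p} → Prime p → ∀ e → p ^ e ∣ binom n n → p ^ e ≤ g p
  pow {p} pp e p∣ = [ below , above ]′ (≤-<-connex p r)
    where
    below : p ≤ r → p ^ e ≤ g p
    below p≤r = begin
      p ^ e                     ≤⟨ prime-power∣central pp e n p∣ ⟩
      W                         ≡⟨ sym (*-identityʳ W) ⟩
      W * 1                     ≤⟨ *-monoʳ-≤ W (primeOr1≥1 p {{prime⇒nonZero pp}}) ⟩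
      W * primeOr1 p            ≡⟨ cong (_* primeOr1 p) (sym (smallFactor-in W r (1<prime pp) p≤r)) ⟩
      g p                       ∎
    above : r < p → p ^ e ≤ g p
    above r<p = begin
      p ^ e                     ≤⟨ ^-monoʳ-≤ p {{prime⇒nonZero pp}} (≮⇒≥ e≮) ⟩
      p ^ 1                     ≡⟨ *-identityʳ p ⟩
      p                         ≡⟨ sym (primeOr1-prime pp) ⟩
      primeOr1 p                ≤⟨ m≤n*m (primeOr1 p) (smallFactor W r p) {{>-nonZero (smallFactor≥1 W r p)}} ⟩
      g p                       ∎
      where
      e≮ : ¬ (1 < e)
      e≮ 1<e = <⇒≱ hi (begin
        suc r * suc r           ≤⟨ *-mono-≤ r<p r<p ⟩
        p * p                   ≡⟨ cong (p *_) (sym (*-identityʳ p)) ⟩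
        p ^ 2                   ≤⟨ ^-monoʳ-≤ p {{prime⇒nonZero pp}} 1<e ⟩
        p ^ e                   ≤⟨ prime-power∣central pp e n p∣ ⟩
        2 * n                   ∎)

-- Let W = 2n, r = ⌊√W⌋ and M = ⌊W/3⌋. Without a prime, 4^n ≤ W^r · 4^M, and cubing gives 4^n ≤
-- W^(3r). As r² ≤ W, this yields (2^r)^r ≤ (W³)^r, whereas W³ < (r+1)^6 ≤ 2^r. The condition r ≥ 30
-- follows from 900 ≤ 2 · 631; the value 631 is where the chain of primes in `bertrand` ends.
bertrand-large : ∀ n → 631 ≤ n → PrimeBetween n
bertrand-large n 631≤n with primeBetween? n
... | yes z = z
... | no none with isqrt (2 * n)
...   | r , lo , hi = ⊥-elim (<⇒≱ (^-monoˡ-< r W³<2^r) 2^r≤)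
  where
  open ≤-Reasoning
  W = 2 * n
  M = 2 * n / 3
  30≤r : 30 ≤ r
  30≤r with 30 ≤? r
  ... | yes z = z
  ... | no  z = contradiction hi (≤⇒≯ (≤-trans (*-mono-≤ (≰⇒> z) (≰⇒> z))
                  (≤-trans (≤ᵇ⇒≤ 900 1262 _) (*-monoʳ-≤ 2 631≤n))))
  instance
    _ = >-nonZero (≤-trans (s≤s z≤n) 30≤r)
    _ = >-nonZero (≤-trans (s≤s z≤n) 631≤n)
    _ = m*n≢0 2 n
    _ = m^n≢0 4 (2 * n)
  W³<2^r : W ^ 3 < 2 ^ r
  W³<2^r = begin-strict
    W ^ 3                     <⟨ ^-monoˡ-< 3 hi ⟩
    (suc r * suc r) ^ 3       ≡⟨ cong (λ z → (suc r * z) ^ 3) (sym (*-identityʳ (suc r))) ⟩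
    (suc r ^ 2) ^ 3           ≡⟨ ^-*-assoc (suc r) 2 3 ⟩
    suc r ^ 6                 ≤⟨ sixth-power≤2^ 30≤r ⟩
    2 ^ r                     ∎
  4^n≤ : 4 ^ n ≤ W ^ r * 4 ^ M
  4^n≤ = begin
    4 ^ n                             ≡⟨ cong (4 ^_) (sym (suc-pred n)) ⟩
    4 ^ suc (pred n)                  ≤⟨ central-≥ (pred n) ⟩
    2 * suc (pred n) * binom (suc (pred n)) (suc (pred n)) ≡⟨ cong (λ z → 2 * z * binom z z) (suc-pred n) ⟩
    W * binom n n                     ≤⟨ *-monoʳ-≤ W (central-≤ n (≤-trans (s≤s (s≤s (s≤s z≤n))) 631≤n) none r hi) ⟩
    W * (W ^ pred r * 4 ^ M)          ≡⟨ sym (*-assoc W (W ^ pred r) (4 ^ M)) ⟩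
    W ^ suc (pred r) * 4 ^ M          ≡⟨ cong (λ z → W ^ z * 4 ^ M) (suc-pred r) ⟩
    W ^ r * 4 ^ M                     ∎
  4^n≤W³ʳ : 4 ^ n ≤ (W ^ 3) ^ r
  4^n≤W³ʳ = *-cancelʳ-≤ (4 ^ n) ((W ^ 3) ^ r) (4 ^ (2 * n)) (begin
    4 ^ n * 4 ^ (2 * n)               ≡⟨ sym (^-distribˡ-+-* 4 n (2 * n)) ⟩
    4 ^ (n + 2 * n)                   ≡⟨ cong (4 ^_) (*-comm 3 n) ⟩
    4 ^ (n * 3)                       ≡⟨ sym (^-*-assoc 4 n 3) ⟩
    (4 ^ n) ^ 3                       ≤⟨ ^-monoˡ-≤ 3 4^n≤ ⟩
    (W ^ r * 4 ^ M) ^ 3               ≡⟨ ^-distribʳ-* 3 (W ^ r) (4 ^ M) ⟩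
    (W ^ r) ^ 3 * (4 ^ M) ^ 3         ≡⟨ cong₂ _*_ (trans (^-*-assoc W r 3) (trans (cong (W ^_) (*-comm r 3)) (sym (^-*-assoc W 3 r)))) (^-*-assoc 4 M 3) ⟩
    (W ^ 3) ^ r * 4 ^ (M * 3)         ≤⟨ *-monoʳ-≤ ((W ^ 3) ^ r) (^-monoʳ-≤ 4 (m/n*n≤m (2 * n) 3)) ⟩
    (W ^ 3) ^ r * 4 ^ (2 * n)         ∎)
  2^r≤ : (2 ^ r) ^ r ≤ (W ^ 3) ^ r
  2^r≤ = begin
    (2 ^ r) ^ r               ≡⟨ ^-*-assoc 2 r r ⟩
    2 ^ (r * r)               ≤⟨ ^-monoʳ-≤ 2 lo ⟩
    2 ^ (2 * n)               ≡⟨ sym (^-*-assoc 2 2 n) ⟩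
    4 ^ n                     ≤⟨ 4^n≤W³ʳ ⟩
    (W ^ 3) ^ r               ∎

-- Below 631 a chain of primes suffices, each at most twice its predecessor: the first one above n
-- is at most 2n.
bertrand : ∀ n → .{{NonZero n}} → PrimeBetween n
bertrand n with 631 ≤? n
... | yes 631≤n = bertrand-large n 631≤n
... | no  631≰n = link 317 631 (link 163 317 (link 83 163 (link 43 83 (link 23 43 (link 13 23
                  (link 7 13 (link 5 7 (link 3 5 (link 2 3 (λ n<2 → 2 , prime[2] , n<2 , *-monoʳ-≤ 2 (>-nonZero⁻¹ n))))))))))) (≰⇒> 631≰n)
  where
  link : ∀ p q → {True (prime? q)} → {True (q ≤? 2 * p)} → (n < p → PrimeBetween n) → n < q → PrimeBetween n
  link p q {pq} {q≤2p} below n<q with n <? p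
  ... | yes n<p = below n<p
  ... | no  n≮p = q , toWitness pq , n<q , ≤-trans (toWitness q≤2p) (*-monoʳ-≤ 2 (≮⇒≥ n≮p))

-- Counting and the parameters

module _ {A : Set} where

  filterᵇ-mono : ∀ (P Q : A → Bool) → (∀ x → T (P x) → T (Q x)) → ∀ xs →
                 length (filterᵇ P xs) ≤ length (filterᵇ Q xs)
  filterᵇ-mono P Q P⇒Q []       = z≤n
  filterᵇ-mono P Q P⇒Q (x ∷ xs) with P x | Q x | P⇒Q x
  ... | false | false | _ = filterᵇ-mono P Q P⇒Q xs
  ... | false | true  | _ = m≤n⇒m≤1+n (filterᵇ-mono P Q P⇒Q xs)
  ... | true  | false | f = ⊥-elim (f tt)
  ... | true  | true  | _ = s≤s (filterᵇ-mono P Q P⇒Q xs)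

  filterᵇ-⊎ : ∀ (P Q R : A → Bool) {xs} → All (λ x → T (P x) → T (Q x) ⊎ T (R x)) xs →
              length (filterᵇ P xs) ≤ length (filterᵇ Q xs) + length (filterᵇ R xs)
  filterᵇ-⊎ P Q R []       = z≤n
  filterᵇ-⊎ P Q R {x ∷ xs} (f ∷ fs) with P x | Q x | R x | f
  ... | false | false | false | _ = filterᵇ-⊎ P Q R fs
  ... | false | false | true  | _ = ≤-trans (filterᵇ-⊎ P Q R fs) (+-monoʳ-≤ _ (n≤1+n _))
  ... | false | true  | false | _ = m≤n⇒m≤1+n (filterᵇ-⊎ P Q R fs)
  ... | false | true  | true  | _ = m≤n⇒m≤1+n (≤-trans (filterᵇ-⊎ P Q R fs) (+-monoʳ-≤ _ (n≤1+n _)))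
  ... | true  | false | false | g = ⊥-elim (reduce (g tt))
  ... | true  | false | true  | _ = ≤-trans (s≤s (filterᵇ-⊎ P Q R fs)) (≤-reflexive (sym (+-suc _ _)))
  ... | true  | true  | false | _ = s≤s (filterᵇ-⊎ P Q R fs)
  ... | true  | true  | true  | _ = s≤s (≤-trans (filterᵇ-⊎ P Q R fs) (+-monoʳ-≤ _ (n≤1+n _)))

module _ {A B : Set} (R : A → B → Bool) where

  private
    total : List A → List B → ℕ
    total xs ys = sum (map (λ x → length (filterᵇ (R x) ys)) xs)

  total-∷ : ∀ xs y ys → total xs (y ∷ ys) ≡ length (filterᵇ (λ x → R x y) xs) + total xs ys
  total-∷ []       y ys = refl
  total-∷ (x ∷ xs) y ys with R x y
  ... | true  = cong suc (trans (cong (_+_ row) (total-∷ xs y ys)) (lemma row _ (total xs ys)))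
    where
    row = length (filterᵇ (R x) ys)
    lemma : ∀ a b c → a + (b + c) ≡ b + (a + c)
    lemma = solve-∀
  ... | false = trans (cong (_+_ row) (total-∷ xs y ys)) (lemma row _ (total xs ys))
    where
    row = length (filterᵇ (R x) ys)
    lemma : ∀ a b c → a + (b + c) ≡ b + (a + c)
    lemma = solve-∀

  -- The number of related pairs lies between the two sides, counted by rows and by columns.
  double-counting : ∀ {lo hi} xs ys → All (λ x → lo ≤ length (filterᵇ (R x) ys)) xs →
                    (∀ y → length (filterᵇ (λ x → R x y) xs) ≤ hi) →
                    length xs * lo ≤ length ys * hi
  double-counting {lo} {hi} xs ys rows columns = ≤-trans (by-rows xs rows) (by-columns ys)
    where
    by-rows : ∀ xs → All (λ x → lo ≤ length (filterᵇ (R x) ys)) xs → length xs * lo ≤ total xs ys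
    by-rows []       []           = z≤n
    by-rows (x ∷ xs) (row ∷ rows) = +-mono-≤ row (by-rows xs rows)
    total-[] : ∀ xs → total xs [] ≡ 0
    total-[] []       = refl
    total-[] (x ∷ xs) = total-[] xs
    by-columns : ∀ ys → total xs ys ≤ length ys * hi
    by-columns []       = ≤-reflexive (total-[] xs)
    by-columns (y ∷ ys) = ≤-trans (≤-reflexive (total-∷ xs y ys)) (+-mono-≤ (columns y) (by-columns ys))

-- Division with remainder and estimates for the parameters

module _ {r k} .{{_ : NonZero k}} (r<k : r < k) (y : ℕ) where

  remainder : (r + y * k) % k ≡ r
  remainder = trans ([m+kn]%n≡m%n r y k) (m<n⇒m%n≡m r<k)

  quotient-of : (r + y * k) / k ≡ y
  quotient-of = trans (+-distrib-/-∣ʳ r (n∣m*n y)) (cong₂ _+_ (m<n⇒m/n≡0 r<k) (m*n/n≡m y k))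

-- Bernoulli's inequality (1 + 1/x)^n ≥ 1 + n/x with the denominators cleared.
bernoulli : ∀ x n → x ^ n * (x + n) ≤ x * suc x ^ n
bernoulli x zero    = ≤-reflexive (lemma x)
  where
  lemma : ∀ x → 1 * (x + 0) ≡ x * 1
  lemma = solve-∀
bernoulli x (suc n) = begin
  x * x ^ n * (x + suc n)           ≤⟨ m≤m+n _ (x ^ n * n) ⟩
  x * x ^ n * (x + suc n) + x ^ n * n ≡⟨ lemma₁ x n (x ^ n) ⟩
  x ^ n * (x + n) * suc x           ≤⟨ *-monoˡ-≤ (suc x) (bernoulli x n) ⟩
  x * suc x ^ n * suc x             ≡⟨ lemma₂ x (suc x) (suc x ^ n) ⟩
  x * (suc x * suc x ^ n)           ∎
  where
  open ≤-Reasoning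
  lemma₁ : ∀ x n p → x * p * (x + suc n) + p * n ≡ p * (x + n) * suc x
  lemma₁ = solve-∀
  lemma₂ : ∀ x s p → x * p * s ≡ x * (s * p)
  lemma₂ = solve-∀

n≤2^n : ∀ n → n ≤ 2 ^ n
n≤2^n zero    = z≤n
n≤2^n (suc n) = ≤-trans (+-mono-≤ (m^n>0 2 n) (n≤2^n n)) (≤-reflexive (cong (_+_ (2 ^ n)) (sym (+-identityʳ (2 ^ n)))))

-- With b = d+1 the exponent b · m is admissible: Δ/b ≥ 1 + 1/b and (1 + 1/b)^b ≥ 2, so (Δ/b)^(bm) ≥
-- 2^m ≥ m. The bound is free of Δ, as the message length requires.
ceilLog-≤ : ∀ {Δ d m t} → suc d < Δ → IsCeilLog Δ d m t → t ≤ suc d * m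
ceilLog-≤ {Δ} {d} {m} d<Δ (_ , least) = least (b * m) (begin
  m * b ^ (b * m)                   ≡⟨ cong (m *_) (sym (^-*-assoc b b m)) ⟩
  m * (b ^ b) ^ m                   ≤⟨ *-monoˡ-≤ ((b ^ b) ^ m) (n≤2^n m) ⟩
  2 ^ m * (b ^ b) ^ m               ≡⟨ sym (^-distribʳ-* m 2 (b ^ b)) ⟩
  (2 * b ^ b) ^ m                   ≤⟨ ^-monoˡ-≤ m (*-cancelˡ-≤ b (≤-trans (≤-reflexive (lemma b (b ^ b))) (bernoulli b b))) ⟩
  (suc b ^ b) ^ m                   ≡⟨ ^-*-assoc (suc b) b m ⟩
  suc b ^ (b * m)                   ≤⟨ ^-monoˡ-≤ (b * m) d<Δ ⟩
  Δ ^ (b * m)                       ∎)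
  where
  open ≤-Reasoning
  b = suc d
  lemma : ∀ b p → b * (2 * p) ≡ p * (b + b)
  lemma = solve-∀

n≤2^⌈log₂n⌉ : ∀ n → n ≤ 2 ^ ⌈log₂ n ⌉
n≤2^⌈log₂n⌉ = <-rec _ go
  where
  open ≤-Reasoning
  go : ∀ n → (∀ {m} → m < n → m ≤ 2 ^ ⌈log₂ m ⌉) → n ≤ 2 ^ ⌈log₂ n ⌉
  go 0 _ = z≤n
  go 1 _ = m^n>0 2 ⌈log₂ 1 ⌉
  go n@(suc (suc n-2)) rec = begin
    n                               ≡⟨ sym (⌊n/2⌋+⌈n/2⌉≡n n) ⟩
    ⌊ n /2⌋ + ⌈ n /2⌉               ≤⟨ +-mono-≤ (≤-trans (⌊n/2⌋≤⌈n/2⌉ n) ih) ih ⟩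
    2 ^ (L ∸ 1) + 2 ^ (L ∸ 1)       ≡⟨ cong (_+_ (2 ^ (L ∸ 1))) (sym (+-identityʳ _)) ⟩
    2 ^ suc (L ∸ 1)                 ≡⟨ cong (2 ^_) (m+[n∸m]≡n 1≤L) ⟩
    2 ^ L                           ∎
    where
    L = ⌈log₂ n ⌉
    ih : ⌈ n /2⌉ ≤ 2 ^ (L ∸ 1)
    ih = subst (λ l → ⌈ n /2⌉ ≤ 2 ^ l) (⌈log₂⌈n/2⌉⌉≡⌈log₂n⌉∸1 n) (rec (⌈n/2⌉<n n-2))
    1≤L : 1 ≤ L
    1≤L = ⌈log₂⌉-mono-≤ {2} {n} (s≤s (s≤s z≤n))

cdiv-* : ∀ a b → .{{NonZero b}} → a ≤ cdiv a b * b
cdiv-* a (suc b) = +-cancelʳ-≤ b a _ (begin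
  a + b                                              ≡⟨ m≡m%n+[m/n]*n (a + b) (suc b) ⟩
  (a + b) % suc b + (a + b) / suc b * suc b          ≤⟨ +-monoˡ-≤ _ (≤-pred (m%n<n (a + b) (suc b))) ⟩
  b + (a + b) / suc b * suc b                        ≡⟨ +-comm b _ ⟩
  (a + b) / suc b * suc b + b                        ∎)
  where open ≤-Reasoning

-- `large` leaves some position unblocked, `small` keeps the numbers of colours and rounds within
-- the budget, and `enough` provides distinct polynomials.
record FieldSize (Δ d m t : ℕ) : Set where
  field
    q      : ℕ
    isPrime : Prime q
    large  : Δ * (t + t) < q * suc d
    small  : q * suc d ≤ 4 * Δ * t
    enough : m ≤ q ^ t

-- Bertrand's postulate is applied to N = ⌊2tΔ/(d+1)⌋. Then Δ/(d+1) < q, and m ≤ (Δ/(d+1))^t gives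
-- `enough`.
fieldSize : ∀ {Δ d m t} → .{{NonZero t}} → suc d < Δ → IsCeilLog Δ d m t → FieldSize Δ d m t
fieldSize {Δ} {d} {m} {t} d<Δ (m≤ , _) with bertrand N {{N≢0}}
  where
  N = Δ * (t + t) / suc d
  N≢0 : NonZero N
  N≢0 = >-nonZero (m≥n⇒m/n>0 (≤-trans (<⇒≤ d<Δ) (m≤m*n Δ (t + t) {{>-nonZero (≤-trans (>-nonZero⁻¹ t) (m≤m+n t t))}})))
... | q , pq , N<q , q≤2N = record
  { q = q ; isPrime = pq ; large = large ; small = small ; enough = enough }
  where
  open ≤-Reasoning
  large : Δ * (t + t) < q * suc d
  large = m/o<n⇒m<n*o N<q
  small : q * suc d ≤ 4 * Δ * t
  small = begin
    q * suc d                                   ≤⟨ *-monoˡ-≤ (suc d) q≤2N ⟩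
    2 * (Δ * (t + t) / suc d) * suc d           ≡⟨ *-assoc 2 (Δ * (t + t) / suc d) (suc d) ⟩
    2 * (Δ * (t + t) / suc d * suc d)           ≤⟨ *-monoʳ-≤ 2 (m/n*n≤m (Δ * (t + t)) (suc d)) ⟩
    2 * (Δ * (t + t))                           ≡⟨ lemma Δ t ⟩
    4 * Δ * t                                   ∎
    where
    lemma : ∀ Δ t → 2 * (Δ * (t + t)) ≡ 4 * Δ * t
    lemma = solve-∀
  enough : m ≤ q ^ t
  enough = *-cancelʳ-≤ m (q ^ t) (suc d ^ t) {{m^n≢0 (suc d) t}} (begin
    m * suc d ^ t                               ≤⟨ m≤ ⟩
    Δ ^ t                                       ≤⟨ ^-monoˡ-≤ t (≤-trans (m≤m*n Δ (t + t) {{>-nonZero (≤-trans (>-nonZero⁻¹ t) (m≤m+n t t))}}) (<⇒≤ large)) ⟩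
    (q * suc d) ^ t                             ≡⟨ ^-distribʳ-* t q (suc d) ⟩
    q ^ t * suc d ^ t                           ∎)

-- 2 n m bounds an adopted position and m the input colours.
message-≤ : ∀ a n m → .{{NonZero n}} → m ≤ n ^ a →
            (2 + 2 * (n * m)) * m ≤ 2 ^ ((3 + (a + a)) * suc ⌈log₂ n ⌉)
message-≤ a n m m≤nᵃ = begin
  (2 + 2 * (n * m)) * m               ≤⟨ *-mono-≤ (+-mono-≤ (*-monoʳ-≤ 2 (m^n>0 n a)) (*-monoʳ-≤ 2 (*-monoʳ-≤ n m≤nᵃ))) m≤nᵃ ⟩
  (2 * A + 2 * (n * A)) * A           ≤⟨ *-monoˡ-≤ A (+-monoˡ-≤ (2 * (n * A)) (*-monoʳ-≤ 2 (m≤n*m A n))) ⟩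
  (2 * (n * A) + 2 * (n * A)) * A     ≡⟨ lemma n A ⟩
  2 ^ 2 * (n * (A * A))               ≡⟨ cong (λ z → 2 ^ 2 * (n * z)) (sym (^-distribˡ-+-* n a a)) ⟩
  2 ^ 2 * n ^ suc (a + a)             ≤⟨ *-monoʳ-≤ (2 ^ 2) (^-monoˡ-≤ (suc (a + a)) (n≤2^⌈log₂n⌉ n)) ⟩
  2 ^ 2 * (2 ^ L) ^ suc (a + a)       ≡⟨ cong (2 ^ 2 *_) (^-*-assoc 2 L (suc (a + a))) ⟩
  2 ^ 2 * 2 ^ (L * suc (a + a))       ≡⟨ sym (^-distribˡ-+-* 2 2 (L * suc (a + a))) ⟩
  2 ^ (2 + L * suc (a + a))           ≤⟨ ^-monoʳ-≤ 2 (subst (2 + L * suc (a + a) ≤_) (lemma₂ L a) (m≤m+n _ (suc (a + a) + 2 * L))) ⟩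
  2 ^ ((3 + (a + a)) * suc L)         ∎
  where
  open ≤-Reasoning
  A = n ^ a
  L = ⌈log₂ n ⌉
  instance _ = m^n≢0 n a
  lemma : ∀ n A → (2 * (n * A) + 2 * (n * A)) * A ≡ 4 * (n * (A * A))
  lemma = solve-∀
  lemma₂ : ∀ L a → 2 + L * suc (a + a) + (suc (a + a) + 2 * L) ≡ (3 + (a + a)) * suc L
  lemma₂ = solve-∀

-- Polynomials modulo a prime

eval : ∀ {n} → Vec ℤ n → ℤ → ℤ
eval []      x = 0ℤ
eval (a ∷ f) x = a ℤ.+ x ℤ.* eval f x

eval-- : ∀ {n} (f g : Vec ℤ n) x → eval (zipWith ℤ._-_ f g) x ≡ eval f x ℤ.- eval g x
eval-- []      []      x = refl
eval-- (a ∷ f) (b ∷ g) x = trans (cong (λ z → (a ℤ.- b) ℤ.+ x ℤ.* z) (eval-- f g x)) (lemma a b x (eval f x) (eval g x))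
  where
  lemma : ∀ a b x u v → (a ℤ.- b) ℤ.+ x ℤ.* (u ℤ.- v) ≡ (a ℤ.+ x ℤ.* u) ℤ.- (b ℤ.+ x ℤ.* v)
  lemma = solveℤ-∀

-- Synthetic division: the quotient of f - f(a) by x - a, by Horner's scheme.
deflate : ∀ {n} → ℤ → Vec ℤ (suc n) → Vec ℤ n
deflate a (_ ∷ [])    = []
deflate a (_ ∷ b ∷ f) = eval (b ∷ f) a ∷ deflate a (b ∷ f)

eval-deflate : ∀ {n} a (f : Vec ℤ (suc n)) x → eval f x ≡ eval f a ℤ.+ (x ℤ.- a) ℤ.* eval (deflate a f) x
eval-deflate a (c ∷ []) x = lemma a c x
  where
  lemma : ∀ a c x → c ℤ.+ x ℤ.* 0ℤ ≡ c ℤ.+ a ℤ.* 0ℤ ℤ.+ (x ℤ.- a) ℤ.* 0ℤ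
  lemma = solveℤ-∀
eval-deflate a (c ∷ f@(_ ∷ _)) x =
  trans (cong (λ z → c ℤ.+ x ℤ.* z) (eval-deflate a f x)) (lemma a c x (eval f a) (eval (deflate a f) x))
  where
  lemma : ∀ a c x u v → c ℤ.+ x ℤ.* (u ℤ.+ (x ℤ.- a) ℤ.* v) ≡ c ℤ.+ a ℤ.* u ℤ.+ (x ℤ.- a) ℤ.* (u ℤ.+ x ℤ.* v)
  lemma = solveℤ-∀

-- The coefficients of f are those of f(a) + (x - a) · g for the quotient g. Read contrapositively,
-- dividing out a root keeps a polynomial nonzero modulo k.
∣-deflate : ∀ {n} k a (f : Vec ℤ (suc n)) → k ∣ℤ eval f a → VAll.All (k ∣ℤ_) (deflate a f) → VAll.All (k ∣ℤ_) f
∣-deflate k a (c ∷ []) k∣fa _ = subst (k ∣ℤ_) (lemma a c) k∣fa VAll.∷ VAll.[]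
  where
  lemma : ∀ a c → c ℤ.+ a ℤ.* 0ℤ ≡ c
  lemma = solveℤ-∀
∣-deflate k a (c ∷ f@(_ ∷ _)) k∣fa (k∣e VAll.∷ k∣g) =
  ℤ∣.∣m+n∣n⇒∣m k∣fa (ℤ∣.∣n⇒∣m*n a k∣e) VAll.∷ ∣-deflate k a f k∣e k∣g

∣-⇒≡ : ∀ {q a b} → a < q → b < q → + q ∣ℤ + a ℤ.- + b → a ≡ b
∣-⇒≡ {q} {a} {b} a<q b<q q∣ = ≤-antisym (≤-from a<q q∣⊖)
  (≤-from b<q (subst (λ z → q ∣ z) (ℤₚ.∣m⊖n∣≡∣n⊖m∣ a b) q∣⊖))
  where
  q∣⊖ : q ∣ ℤ.∣ a ℤ.⊖ b ∣
  q∣⊖ = subst (λ z → q ∣ ℤ.∣ z ∣) (ℤₚ.m-n≡m⊖n a b) (ℤ∣.∣⇒∣ᵤ q∣)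
  ≤-from : ∀ {a b} → a < q → q ∣ ℤ.∣ a ℤ.⊖ b ∣ → a ≤ b
  ≤-from {a} {b} a<q q∣ with a ≤? b
  ... | yes a≤b = a≤b
  ... | no  a≰b = contradiction (subst (q ∣_) (trans (ℤₚ.∣m⊖n∣≡∣n⊖m∣ a b) (ℤₚ.∣⊖∣-≤ (≰⇒≥ a≰b))) q∣)
                    (prime∤small (a ∸ b) {{>-nonZero (m<n⇒0<n∸m (≰⇒> a≰b))}} (≤-<-trans (m∸n≤m a b) a<q))

%≡⇒∣- : ∀ {q a b} .{{_ : NonZero q}} → a % q ≡ b % q → + q ∣ℤ + a ℤ.- + b
%≡⇒∣- {q} {a} {b} eq = ℤ∣.divides (+ (a / q) ℤ.- + (b / q)) (begin
  + a ℤ.- + b                                       ≡⟨ cong₂ ℤ._-_ (split a) (split b) ⟩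
  (+ (a % q) ℤ.+ + (a / q) ℤ.* + q) ℤ.- (+ (b % q) ℤ.+ + (b / q) ℤ.* + q)
                                                    ≡⟨ cong (λ r → (+ r ℤ.+ + (a / q) ℤ.* + q) ℤ.- (+ (b % q) ℤ.+ + (b / q) ℤ.* + q)) eq ⟩
  (+ (b % q) ℤ.+ + (a / q) ℤ.* + q) ℤ.- (+ (b % q) ℤ.+ + (b / q) ℤ.* + q)
                                                    ≡⟨ lemma (+ (b % q)) (+ (a / q)) (+ (b / q)) (+ q) ⟩
  (+ (a / q) ℤ.- + (b / q)) ℤ.* + q                 ∎)
  where
  open ≡-Reasoning
  split : ∀ a → + a ≡ + (a % q) ℤ.+ + (a / q) ℤ.* + q
  split a = trans (cong +_ (m≡m%n+[m/n]*n a q)) (trans (ℤₚ.pos-+ (a % q) _) (cong (λ z → + (a % q) ℤ.+ z) (ℤₚ.pos-* (a / q) q)))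
  lemma : ∀ r u v q → (r ℤ.+ u ℤ.* q) ℤ.- (r ℤ.+ v ℤ.* q) ≡ (u ℤ.- v) ℤ.* q
  lemma = solveℤ-∀

euclidℤ : ∀ {q} → Prime q → ∀ a b → + q ∣ℤ a ℤ.* b → + q ∣ℤ a ⊎ + q ∣ℤ b
euclidℤ {q} pq a b q∣ =
  Sum.map ℤ∣.∣ᵤ⇒∣ ℤ∣.∣ᵤ⇒∣ (euclidsLemma ℤ.∣ a ∣ ℤ.∣ b ∣ pq (subst (q ∣_) (ℤₚ.abs-* a b) (ℤ∣.∣⇒∣ᵤ q∣)))

-- Lagrange's bound, with vanishing modulo q stated as divisibility of all coefficients. A root a is
-- divided out; any other root x in the list satisfies q ∤ x - a, both being below q, so it is a
-- root of the quotient.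
roots-≤ : ∀ {q} → Prime q → ∀ {t} (f : Vec ℤ (suc t)) → ¬ VAll.All (+ q ∣ℤ_) f →
          ∀ {xs} → Unique xs → All (_< q) xs → All (λ x → + q ∣ℤ eval f (+ x)) xs → length xs ≤ t
roots-≤ pq f ¬0 [] [] [] = z≤n
roots-≤ pq {zero}  f ¬0 {x ∷ _} _ _ (root ∷ _) = contradiction (∣-deflate _ (+ x) f root (nil (deflate (+ x) f))) ¬0
  where
  nil : ∀ {k} (g : Vec ℤ 0) → VAll.All (k ∣ℤ_) g
  nil [] = VAll.[]
roots-≤ {q} pq {suc t} f ¬0 {a ∷ xs} (a∉ ∷ uniq) (a<q ∷ <q) (root ∷ roots) =
  s≤s (roots-≤ pq (deflate (+ a) f) (¬0 ∘ ∣-deflate _ (+ a) f root) uniq <q (All.zipWith root′ (All.zip (a∉ , <q) , roots)))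
  where
  root′ : ∀ {x} → (a ≢ x × x < q) × + q ∣ℤ eval f (+ x) → + q ∣ℤ eval (deflate (+ a) f) (+ x)
  root′ {x} ((a≢x , x<q) , q∣fx) =
    [ (λ q∣x-a → contradiction (sym (∣-⇒≡ x<q a<q q∣x-a)) a≢x) , (λ d → d) ]′
      (euclidℤ pq (+ x ℤ.- + a) _ (subst (+ q ∣ℤ_) (lemma _ _ _ (eval-deflate (+ a) f (+ x))) (ℤ∣.∣m∣n⇒∣m-n q∣fx root)))
    where
    lemma : ∀ u v w → u ≡ v ℤ.+ w → u ℤ.- v ≡ w
    lemma _ v w refl = cancel v w
      where
      cancel : ∀ v w → (v ℤ.+ w) ℤ.- v ≡ w
      cancel = solveℤ-∀

count : (ℕ → Bool) → ℕ → ℕ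
count P y = length (filterᵇ P (upTo y))

count-roots-≤ : ∀ {q} → Prime q → ∀ {t} (f : Vec ℤ (suc t)) → ¬ VAll.All (+ q ∣ℤ_) f →
                ∀ P {y} → y ≤ q → (∀ x → T (P x) → + q ∣ℤ eval f (+ x)) → count P y ≤ t
count-roots-≤ pq f ¬0 P {y} y≤q root = roots-≤ pq f ¬0
  (Unique.filter⁺ (T? ∘ P) (Unique.upTo⁺ y))
  (Allₚ.filter⁺ (T? ∘ P) (All.map (λ x<y → <-≤-trans x<y y≤q) (Allₚ.all-upTo y)))
  (All.map (λ {x} → root x) (Allₚ.all-filter (T? ∘ P) (upTo y)))

module Code (q : ℕ) .{{_ : NonZero q}} where

  -- The monic polynomial of degree t whose lower coefficients are the
  -- base-q digits of c.
  code : ℕ → ℕ → ℕ → ℕ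
  code zero    c x = 1
  code (suc t) c x = c % q + x * code t (c / q) x

  coeffs : ∀ t → ℕ → Vec ℤ (suc t)
  coeffs zero    c = + 1 ∷ []
  coeffs (suc t) c = + (c % q) ∷ coeffs t (c / q)

  eval-coeffs : ∀ t c x → eval (coeffs t c) (+ x) ≡ + code t c x
  eval-coeffs zero    c x = trans (cong (λ z → + 1 ℤ.+ z) (ℤₚ.*-zeroʳ (+ x))) refl
  eval-coeffs (suc t) c x = begin
    + (c % q) ℤ.+ + x ℤ.* eval (coeffs t (c / q)) (+ x) ≡⟨ cong (λ z → + (c % q) ℤ.+ + x ℤ.* z) (eval-coeffs t (c / q) x) ⟩
    + (c % q) ℤ.+ + x ℤ.* + code t (c / q) x            ≡⟨ cong (λ z → + (c % q) ℤ.+ z) (sym (ℤₚ.pos-* x _)) ⟩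
    + (c % q) ℤ.+ + (x * code t (c / q) x)              ≡⟨ sym (ℤₚ.pos-+ (c % q) _) ⟩
    + code (suc t) c x                                  ∎
    where open ≡-Reasoning

  coeffs-monic : Prime q → ∀ t c → ¬ VAll.All (+ q ∣ℤ_) (coeffs t c)
  coeffs-monic pq zero    c (q∣1 VAll.∷ _) = <⇒≱ (1<prime pq) (∣⇒≤ (ℤ∣.∣⇒∣ᵤ q∣1))
  coeffs-monic pq (suc t) c (_ VAll.∷ all) = coeffs-monic pq t (c / q) all

  coeffs-injective : ∀ t {c c′} → c < q ^ t → c′ < q ^ t →
                     VAll.All (+ q ∣ℤ_) (zipWith ℤ._-_ (coeffs t c) (coeffs t c′)) → c ≡ c′
  coeffs-injective zero    c< c′< _ = trans (n<1⇒n≡0 c<) (sym (n<1⇒n≡0 c′<))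
  coeffs-injective (suc t) {c} {c′} c< c′< (q∣ VAll.∷ all) = begin
    c                         ≡⟨ m≡m%n+[m/n]*n c q ⟩
    c % q + c / q * q         ≡⟨ cong₂ (λ r s → r + s * q) (∣-⇒≡ (m%n<n c q) (m%n<n c′ q) q∣)
                                       (coeffs-injective t (shrink c<) (shrink c′<) all) ⟩
    c′ % q + c′ / q * q       ≡⟨ sym (m≡m%n+[m/n]*n c′ q) ⟩
    c′                        ∎
    where
    open ≡-Reasoning
    shrink : ∀ {c} → c < q ^ suc t → c / q < q ^ t
    shrink {c} c< = m<n*o⇒m/o<n (subst (c <_) (*-comm q (q ^ t)) c<)

  -- Distinct numbers below q^t differ in a base-q digit, so the difference of their polynomials is
  -- nonzero modulo q.
  agreements-≤ : Prime q → ∀ t {c c′} → c < q ^ t → c′ < q ^ t → c ≢ c′ → ∀ P {y} → y ≤ q →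
                 (∀ x → T (P x) → code t c x % q ≡ code t c′ x % q) → count P y ≤ t
  agreements-≤ pq t {c} {c′} c< c′< c≢c′ P y≤q agree =
    count-roots-≤ pq (zipWith ℤ._-_ (coeffs t c) (coeffs t c′)) (c≢c′ ∘ coeffs-injective t c< c′<) P y≤q
      λ x Px → subst (+ q ∣ℤ_) (sym (trans (eval-- (coeffs t c) (coeffs t c′) (+ x))
                                          (cong₂ ℤ._-_ (eval-coeffs t c x) (eval-coeffs t c′ x))))
                 (%≡⇒∣- (agree x Px))

  -- Since t ≥ 1, subtracting the constant v leaves the leading coefficient 1 in place. This is why
  -- the polynomials are monic: a constant one would repeat its value everywhere.
  repetitions-≤ : Prime q → ∀ t .{{_ : NonZero t}} c v P {y} → y ≤ q →
                  (∀ x → T (P x) → code t c x % q ≡ v) → count P y ≤ t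
  repetitions-≤ pq (suc t) c v P y≤q hit =
    count-roots-≤ pq f (λ { (_ VAll.∷ all) → coeffs-monic pq t (c / q) all }) P y≤q root
    where
    f : Vec ℤ (suc (suc t))
    f = + (c % q) ℤ.- + v ∷ coeffs t (c / q)
    lemma : ∀ a v z → (a ℤ.- v) ℤ.+ z ≡ (a ℤ.+ z) ℤ.- v
    lemma = solveℤ-∀
    root : ∀ x → T (P x) → + q ∣ℤ eval f (+ x)
    root x Px = subst (+ q ∣ℤ_)
      (sym (trans (lemma (+ (c % q)) (+ v) _) (cong (ℤ._- + v) (eval-coeffs (suc t) c x))))
      (%≡⇒∣- {b = v} (trans (sym (m%n%n≡m%n (code (suc t) c x) q)) (cong (_% q) (hit x Px))))

-- The algorithm

T⇒≡ : ∀ {b} → T b → b ≡ true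
T⇒≡ {true} _ = refl

¬T⇒≡ : ∀ {b} → ¬ T b → b ≡ false
¬T⇒≡ {true}  ¬b = ⊥-elim (¬b tt)
¬T⇒≡ {false} _  = refl

precedes : ℕ → ℕ → ℕ → ℕ → Bool
precedes x c x′ c′ = (x <ᵇ x′) ∨ ((x ≡ᵇ x′) ∧ (c <ᵇ c′))

precedes-> : ∀ {x x′} c c′ → x′ < x → precedes x c x′ c′ ≡ false
precedes-> {x} {x′} c c′ x′<x = cong₂ (λ a b → a ∨ (b ∧ (c <ᵇ c′)))
  (¬T⇒≡ {x <ᵇ x′} (λ p → <-asym x′<x (<ᵇ⇒< x x′ p))) (¬T⇒≡ {x ≡ᵇ x′} (λ p → <⇒≢ x′<x (sym (≡ᵇ⇒≡ x x′ p))))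

precedes-< : ∀ {x x′} c c′ → x < x′ → precedes x c x′ c′ ≡ true
precedes-< {x} {x′} c c′ x<x′ = cong (_∨ ((x ≡ᵇ x′) ∧ (c <ᵇ c′))) (T⇒≡ (<⇒<ᵇ x<x′))

precedes-≡ : ∀ x c c′ → precedes x c x c′ ≡ (c <ᵇ c′)
precedes-≡ x c c′ = cong₂ (λ a b → a ∨ (b ∧ (c <ᵇ c′)))
  (¬T⇒≡ {x <ᵇ x} (λ p → <-irrefl refl (<ᵇ⇒< x x p))) (T⇒≡ (≡⇒≡ᵇ x x refl))

precedes⇒≤ : ∀ x c x′ c′ → T (precedes x c x′ c′) → x ≤ x′
precedes⇒≤ x c x′ c′ p with x ≤? x′
... | yes q = q
... | no  q = ⊥-elim (subst T (precedes-> c c′ (≰⇒> q)) p)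

precedes-swap : ∀ x c x′ c′ → c ≢ c′ → precedes x′ c′ x c ≡ not (precedes x c x′ c′)
precedes-swap x c x′ c′ c≢c′ with <-cmp x x′
... | tri< x<x′ _ _ = trans (precedes-> c′ c x<x′) (cong not (sym (precedes-< c c′ x<x′)))
... | tri> _ _ x′<x = trans (precedes-< c′ c x′<x) (cong not (sym (precedes-> c c′ x′<x)))
... | tri≈ _ refl _ = trans (precedes-≡ x c′ c) (trans by-colour (cong not (sym (precedes-≡ x c c′))))
  where
  by-colour : (c′ <ᵇ c) ≡ not (c <ᵇ c′)
  by-colour with <-cmp c c′
  ... | tri< c<c′ _ _ = trans (¬T⇒≡ {c′ <ᵇ c} (λ p → <-asym c<c′ (<ᵇ⇒< c′ c p))) (cong not (sym (T⇒≡ (<⇒<ᵇ c<c′))))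
  ... | tri≈ _ eq _   = contradiction eq c≢c′
  ... | tri> _ _ c′<c = trans (T⇒≡ (<⇒<ᵇ c′<c)) (cong not (sym (¬T⇒≡ {c <ᵇ c′} (λ p → <-asym c′<c (<ᵇ⇒< c c′ p)))))

zero-or-suc : ∀ s → s ≡ 0 ⊎ ∃[ x ] s ≡ suc x
zero-or-suc zero    = inj₁ refl
zero-or-suc (suc x) = inj₂ (x , refl)

module Search (d : ℕ) where

  -- 0 stands for failure and suc x for the position x.
  search : (ℕ → ℕ) → ℕ → ℕ → ℕ
  search f s zero    = 0
  search f s (suc j) with f s ≤? d
  ... | yes _ = suc s
  ... | no  _ = search f (suc s) j

  search-cong : ∀ {f g} → (∀ x → f x ≡ g x) → ∀ s j → search f s j ≡ search g s j
  search-cong f≗g s zero    = refl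
  search-cong {f} {g} f≗g s (suc j) with f s ≤? d | g s ≤? d
  ... | yes _ | yes _ = refl
  ... | no  _ | no  _ = search-cong f≗g (suc s) j
  ... | yes p | no ¬p = contradiction (subst (_≤ d) (f≗g s) p) ¬p
  ... | no ¬p | yes p = contradiction (subst (_≤ d) (sym (f≗g s)) p) ¬p

  search-fails : ∀ f s j → search f s j ≡ 0 → ∀ {x} → s ≤ x → x < s + j → d < f x
  search-fails f s zero    _ {x} s≤x x< = contradiction (subst (x <_) (+-identityʳ s) x<) (≤⇒≯ s≤x)
  search-fails f s (suc j) eq {x} s≤x x< with f s ≤? d
  search-fails f s (suc j) () s≤x x< | yes _
  ... | no fs≰d with m≤n⇒m<n∨m≡n s≤x
  ...   | inj₁ s<x  = search-fails f (suc s) j eq s<x (subst (x <_) (+-suc s j) x<)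
  ...   | inj₂ refl = ≰⇒> fs≰d

  search-finds : ∀ f s j {x} → search f s j ≡ suc x →
                 s ≤ x × x < s + j × f x ≤ d × (∀ {x′} → s ≤ x′ → x′ < x → d < f x′)
  search-finds f s (suc j) {x} eq with f s ≤? d
  search-finds f s (suc j) refl | yes fs≤d =
    ≤-refl , m<m+n s z<s , fs≤d , λ s≤x′ x′<s → contradiction x′<s (≤⇒≯ s≤x′)
  ... | no fs≰d with search-finds f (suc s) j eq
  ...   | s<x , x< , fx≤d , before = <⇒≤ s<x , subst (x <_) (sym (+-suc s j)) x< , fx≤d , before′
    where
    before′ : ∀ {x′} → s ≤ x′ → x′ < x → d < f x′
    before′ s≤x′ x′<x with m≤n⇒m<n∨m≡n s≤x′
    ... | inj₁ s<x′ = before s<x′ x′<x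
    ... | inj₂ refl = ≰⇒> fs≰d

module Scheme (m d k t q : ℕ) .{{_ : NonZero m}} .{{_ : NonZero k}} .{{_ : NonZero q}} where

  open Code q
  open Search d

  value : ℕ → ℕ → ℕ
  value c x = code t c x % q

  -- The pair (x mod k, f(x)) packed into one number below q · k; remainder and quotient by k
  -- recover it.
  hue : ℕ → ℕ → ℕ
  hue c x = x % k + value c x * k

  -- An uncoloured neighbour is a threat only if it adopts the same x in the same round, hence the
  -- comparison at x. A coloured one has a fixed hue.
  clash : (c x c′ s′ : ℕ) → Bool
  clash c x c′ zero     = value c′ x ≡ᵇ value c x
  clash c x c′ (suc x′) = hue c′ x′ ≡ᵇ hue c x

  clashes : ∀ {δ} → ℕ → (Fin δ → ℕ) → (Fin δ → ℕ) → ℕ → ℕ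
  clashes {δ} c cs ss x = length (filterᵇ (λ p → clash c x (cs p) (ss p)) (allFin δ))

  decide : ℕ → ℕ → ℕ
  decide zero    s = s
  decide (suc x) _ = suc x

  -- status is 0 while the vertex is uncoloured and suc x once it has adopted
  -- the position x; view holds the messages of the latest round, each of the
  -- form (input colour) + status * m.
  record Local (δ : ℕ) : Set where
    field
      input  : ℕ
      round  : ℕ
      status : ℕ
      view   : Fin δ → ℕ

  open Local public

  -- A neighbour of unknown position can only have adopted one in the last
  -- round; if its colour equals ours, then so does its position unless ours
  -- is from an earlier round.
  position : (x start s′ : ℕ) → ℕ
  position x start zero     = x ⊔ start
  position x start (suc x′) = x′

  orientation : (x c start s′ c′ : ℕ) → Bool
  orientation x c start s′ c′ = precedes (position x start s′) c′ x c

  algorithm : Algorithm m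
  algorithm = record
    { State     = Local
    ; init      = λ δ c → record { input = toℕ c ; round = 0 ; status = 0 ; view = λ _ → 0 }
    ; send      = λ δ S p → input S + status S * m
    ; receive   = λ δ S msg → record
        { input  = input S
        ; round  = suc (round S)
        ; status = decide (status S)
            (search (clashes (input S) (λ p → msg p % m) (λ p → msg p / m)) (round S * k) k)
        ; view   = msg
        }
    ; outColor  = λ δ S → hue (input S) (pred (status S))
    -- After R rounds, `pred (round S) * k` is the first position tried in the last round, and
    -- `view S` holds the statuses from before that round.
    ; outOrient = λ δ S p → orientation (pred (status S)) (input S) (pred (round S) * k) (view S p / m) (view S p % m)
    ; outPart   = λ δ S → pred (status S) / k
    }

  hue-value : ∀ {c x c′ x′} → hue c x ≡ hue c′ x′ → value c x ≡ value c′ x′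
  hue-value {c} {x} {c′} {x′} eq = begin
    value c x       ≡⟨ sym (quotient-of (m%n<n x k) (value c x)) ⟩
    hue c x / k     ≡⟨ cong (_/ k) eq ⟩
    hue c′ x′ / k   ≡⟨ quotient-of (m%n<n x′ k) (value c′ x′) ⟩
    value c′ x′     ∎
    where open ≡-Reasoning

  hue-% : ∀ {c x c′ x′} → hue c x ≡ hue c′ x′ → x % k ≡ x′ % k
  hue-% {c} {x} {c′} {x′} eq = begin
    x % k           ≡⟨ sym (remainder (m%n<n x k) (value c x)) ⟩
    hue c x % k     ≡⟨ cong (_% k) eq ⟩
    hue c′ x′ % k   ≡⟨ remainder (m%n<n x′ k) (value c′ x′) ⟩
    x′ % k          ∎
    where open ≡-Reasoning

  hue-< : ∀ c x → hue c x < q * k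
  hue-< c x = ≤-trans (+-monoˡ-≤ (value c x * k) (m%n<n x k)) (*-monoˡ-≤ k (m%n<n (code t c x) q))

  batch : ∀ {r x} → r * k ≤ x → x < r * k + k → x / k ≡ r
  batch {r} {x} lo hi = begin
    x / k                       ≡⟨ cong (_/ k) (sym (m∸n+n≡m lo)) ⟩
    (x ∸ r * k + r * k) / k     ≡⟨ quotient-of (+-cancelʳ-< (r * k) (x ∸ r * k) k
                                     (subst₂ _<_ (sym (m∸n+n≡m lo)) (+-comm (r * k) k) hi)) r ⟩
    r                           ∎
    where open ≡-Reasoning

  -- Correctness of the run on a graph

  module Analysis
    {Δ : ℕ} .{{_ : NonZero t}} (pq : Prime q) (large : Δ * (t + t) < q * suc d) (enough : m ≤ q ^ t)
    (R : ℕ) (covers : q ≤ R * k)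
    (G : Graph) (col : Fin (n G) → Fin m) (maxDeg : MaxDegree≤ G Δ) (proper : Proper G m col)
    where

    state : ℕ → (v : Fin (n G)) → Local (deg G v)
    state = run algorithm G col

    c : Fin (n G) → ℕ
    c v = toℕ (col v)

    σ : ℕ → Fin (n G) → ℕ
    σ r v = status (state r v)

    input-state : ∀ r v → input (state r v) ≡ c v
    input-state zero    v = refl
    input-state (suc r) v = input-state r v

    round-state : ∀ r v → round (state r v) ≡ r
    round-state zero    v = refl
    round-state (suc r) v = cong suc (round-state r v)

    message-% : ∀ r v p → view (state (suc r) v) p % m ≡ c (nbr G v p)
    message-% r v p = trans (cong (λ z → (z + σ r (nbr G v p) * m) % m) (input-state r (nbr G v p)))
                            (remainder (toℕ<n (col (nbr G v p))) (σ r (nbr G v p)))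

    message-/ : ∀ r v p → view (state (suc r) v) p / m ≡ σ r (nbr G v p)
    message-/ r v p = trans (cong (λ z → (z + σ r (nbr G v p) * m) / m) (input-state r (nbr G v p)))
                            (quotient-of (toℕ<n (col (nbr G v p))) (σ r (nbr G v p)))

    clashAt : ℕ → (v : Fin (n G)) → ℕ → Fin (deg G v) → Bool
    clashAt r v x p = clash (c v) x (c (nbr G v p)) (σ r (nbr G v p))

    conflicts : ℕ → Fin (n G) → ℕ → ℕ
    conflicts r v x = length (filterᵇ (clashAt r v x) (allFin (deg G v)))

    σ-step : ∀ r v → σ (suc r) v ≡ decide (σ r v) (search (conflicts r v) (r * k) k)
    σ-step r v = cong (decide (σ r v))
      (trans (cong (λ z → search received (z * k) k) (round-state r v)) (search-cong received≡ (r * k) k))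
      where
      msg = view (state (suc r) v)
      received : ℕ → ℕ
      received = clashes (input (state r v)) (λ p → msg p % m) (λ p → msg p / m)
      clash≡ : ∀ x p → clash (input (state r v)) x (msg p % m) (msg p / m) ≡ clashAt r v x p
      clash≡ x p = trans (cong (λ z → clash z x (msg p % m) (msg p / m)) (input-state r v))
                         (cong₂ (clash (c v) x) (message-% r v p) (message-/ r v p))
      received≡ : ∀ x → received x ≡ conflicts r v x
      -- The two predicates agree only pointwise, so the counts are compared by monotonicity in both
      -- directions.
      received≡ x = ≤-antisym
        (filterᵇ-mono _ _ (λ p → subst T (clash≡ x p)) (allFin (deg G v)))
        (filterᵇ-mono _ _ (λ p → subst T (sym (clash≡ x p))) (allFin (deg G v)))

    σ-zero : ∀ r v → σ r v ≡ 0 → σ (suc r) v ≡ search (conflicts r v) (r * k) k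
    σ-zero r v eq = trans (σ-step r v) (cong (λ s → decide s (search (conflicts r v) (r * k) k)) eq)

    σ-suc : ∀ r v {x} → σ r v ≡ suc x → σ (suc r) v ≡ suc x
    σ-suc r v eq = trans (σ-step r v) (cong (λ s → decide s (search (conflicts r v) (r * k) k)) eq)

    persists : ∀ {r r′ v x} → r ≤′ r′ → σ r v ≡ suc x → σ r′ v ≡ suc x
    persists     ≤′-refl             eq = eq
    persists {v = v} (≤′-step {r′} r≤r′) eq = σ-suc r′ v (persists r≤r′ eq)

    -- Position x is tried in round x / k, so its conflicts are counted with the statuses of that
    -- round.
    undecided : ∀ r v → σ r v ≡ 0 → ∀ {x} → x < r * k → d < conflicts (x / k) v x
    undecided (suc r) v eq {x} x< with zero-or-suc (σ r v)
    ... | inj₂ (_ , eqᵣ) = contradiction (trans (sym (σ-suc r v eqᵣ)) eq) λ ()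
    ... | inj₁ eqᵣ with x <? r * k
    ...   | yes x<rk = undecided r v eqᵣ x<rk
    ...   | no  x≮rk = subst (λ z → d < conflicts z v x) (sym (batch {r} (≮⇒≥ x≮rk) x<rk+k))
              (search-fails (conflicts r v) (r * k) k
                (trans (sym (σ-zero r v eqᵣ)) eq) (≮⇒≥ x≮rk) x<rk+k)
      where
      x<rk+k : x < r * k + k
      x<rk+k = subst (x <_) (+-comm k (r * k)) x<

    -- The last component reaches back over all rounds: positions of earlier batches were rejected
    -- by `undecided`, those of the current one by the search.
    decided : ∀ r v {x} → σ r v ≡ suc x →
              x / k < r × conflicts (x / k) v x ≤ d × (∀ {x′} → x′ < x → d < conflicts (x′ / k) v x′)
    decided (suc r) v {x} eq with zero-or-suc (σ r v)
    ... | inj₂ (_ , eqᵣ) with decided r v (trans eqᵣ (trans (sym (σ-suc r v eqᵣ)) eq))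
    ...   | x/k<r , ok , before = m<n⇒m<1+n x/k<r , ok , before
    decided (suc r) v {x} eq | inj₁ eqᵣ
      with search-finds (conflicts r v) (r * k) k (trans (sym (σ-zero r v eqᵣ)) eq)
    ... | lo , hi , ok , before =
      ≤-reflexive (cong suc (batch {r} lo hi)) , subst (λ z → conflicts z v x ≤ d) (sym (batch {r} lo hi)) ok , before′
      where
      before′ : ∀ {x′} → x′ < x → d < conflicts (x′ / k) v x′
      before′ {x′} x′<x with x′ <? r * k
      ... | yes x′<rk = undecided r v eqᵣ x′<rk
      ... | no  x′≮rk = subst (λ z → d < conflicts z v x′) (sym (batch {r} (≮⇒≥ x′≮rk) (<-trans x′<x hi)))
                          (before (≮⇒≥ x′≮rk) x′<x)

    c<q^t : ∀ v → c v < q ^ t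
    c<q^t v = <-≤-trans (toℕ<n (col v)) enough

    hits : Fin (n G) → Fin (n G) → ℕ → ℕ → Bool
    hits u v zero     x = false
    hits u v (suc x′) x = value (c v) x ≡ᵇ value (c u) x′

    -- While u is uncoloured a clash is an agreement of two polynomials; once u
    -- is coloured it is a repetition of a fixed value of the polynomial of v.
    clashes-per-neighbour : ∀ v p {y} → y ≤ q → count (λ x → clashAt (x / k) v x p) y ≤ t + t
    clashes-per-neighbour v p {y} y≤q = ≤-trans
      (filterᵇ-⊎ _ agrees (hits u v (σ y u)) (All.map split (Allₚ.all-upTo y)))
      (+-mono-≤ (agreements-≤ pq t (c<q^t u) (c<q^t v) (λ eq → proper v p (toℕ-injective eq)) agrees y≤q
                  (λ x → ≡ᵇ⇒≡ (value (c u) x) (value (c v) x)))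
                (repetitions (σ y u)))
      where
      u = nbr G v p
      agrees : ℕ → Bool
      agrees x = value (c u) x ≡ᵇ value (c v) x
      repetitions : ∀ s → count (hits u v s) y ≤ t
      repetitions zero     = repetitions-≤ pq t (c v) 0 (hits u v zero) y≤q λ _ ()
      repetitions (suc x′) = repetitions-≤ pq t (c v) (value (c u) x′) (hits u v (suc x′)) y≤q
                               λ x → ≡ᵇ⇒≡ (value (c v) x) (value (c u) x′)
      split : ∀ {x} → x < y → T (clashAt (x / k) v x p) → T (agrees x) ⊎ T (hits u v (σ y u) x)
      split {x} x<y h with σ (x / k) u in eq
      ... | zero   = inj₁ h
      -- An adopted position persists, and x / k ≤ x < y, so the single status `σ y u` serves every
      -- x below y.
      ... | suc x′ = inj₂ (subst (λ s → T (hits u v s x))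
              (sym (persists (≤⇒≤′ (≤-trans (m/n≤m x k) (<⇒≤ x<y))) eq))
              (≡⇒≡ᵇ _ _ (sym (hue-value {c u} {x′} {c v} {x} (≡ᵇ⇒≡ (hue (c u) x′) (hue (c v) x) h)))))

    -- Pairs of a position and a clashing neighbour are counted: at least d+1 per blocked position,
    -- at most 2t per neighbour.
    blocked-≤ : ∀ v {y} → y ≤ q → (∀ {x} → x < y → d < conflicts (x / k) v x) → y * suc d ≤ deg G v * (t + t)
    blocked-≤ v {y} y≤q blocked = subst₂ (λ a b → a * suc d ≤ b * (t + t))
      (length-upTo y) (length-tabulate {n = deg G v} (λ p → p))
      (double-counting (λ x → clashAt (x / k) v x) (upTo y) (allFin (deg G v))
        (All.map blocked (Allₚ.all-upTo y)) (λ p → clashes-per-neighbour v p y≤q))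

    not-all-blocked : ∀ v → ¬ (∀ {x} → x < q → d < conflicts (x / k) v x)
    not-all-blocked v blocked =
      <⇒≱ large (≤-trans (blocked-≤ v ≤-refl blocked) (*-monoˡ-≤ (t + t) (maxDeg v)))

    -- All positions before x were blocked. The count is kept in terms of the actual degree, which
    -- unlike Δ is bounded by the number of vertices.
    adopted-≤ : ∀ r v {x} → σ r v ≡ suc x → x * suc d ≤ deg G v * (t + t)
    adopted-≤ r v {x} eq with decided r v eq
    ... | _ , _ , before with x ≤? q
    ...   | yes x≤q = blocked-≤ v x≤q before
    ...   | no  x≰q = ⊥-elim (not-all-blocked v λ x′<q → before (<-trans x′<q (≰⇒> x≰q)))

    adopted : ∀ v → ∃[ x ] σ R v ≡ suc x
    adopted v with σ R v in eq
    ... | suc x = x , refl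
    ... | zero  = ⊥-elim (not-all-blocked v λ x<q → undecided R v eq (<-≤-trans x<q covers))

    X : Fin (n G) → ℕ
    X v = proj₁ (adopted v)

    ρ : Fin (n G) → ℕ
    ρ v = X v / k

    σ-R : ∀ v → σ R v ≡ suc (X v)
    σ-R v = proj₂ (adopted v)

    ρ<R : ∀ v → ρ v < R
    ρ<R v = proj₁ (decided R v (σ-R v))

    adopted-unique : ∀ {r v x} → r ≤ R → σ r v ≡ suc x → x ≡ X v
    adopted-unique r≤R eq = suc-injective (trans (sym (persists (≤⇒≤′ r≤R) eq)) (σ-R _))

    -- If v were still uncoloured after r rounds, all positions below r · k would have been
    -- rejected, X v among them.
    σ-after : ∀ {r} v → r ≤ R → ρ v < r → σ r v ≡ suc (X v)
    σ-after {r} v r≤R ρ<r with σ r v in eq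
    ... | suc x = cong suc (adopted-unique r≤R eq)
    ... | zero  = contradiction (proj₁ (proj₂ (decided R v (σ-R v))))
                    (<⇒≱ (undecided r v eq (m/o<n⇒m<n*o ρ<r)))

    σ-before : ∀ {r} v → r ≤ ρ v → σ r v ≡ 0
    σ-before {r} v r≤ρ with σ r v in eq
    ... | zero  = refl
    ... | suc x = contradiction (subst (λ x → x / k < r) (adopted-unique (≤-trans r≤ρ (<⇒≤ (ρ<R v))) eq) (proj₁ (decided r v eq)))
                    (≤⇒≯ r≤ρ)

    hueOf : Fin (n G) → ℕ
    hueOf v = hue (c v) (X v)

    color≡ : ∀ v → color algorithm G col R v ≡ hueOf v
    color≡ v = cong₂ hue (input-state R v) (cong pred (σ-R v))

    part≡ : ∀ v → part algorithm G col R v ≡ ρ v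
    part≡ v = cong (λ s → pred s / k) (σ-R v)

    same-round : ∀ {u v} → hueOf u ≡ hueOf v → ρ u ≡ ρ v → X u ≡ X v
    same-round {u} {v} hue≡ ρ≡ = begin
      X u                         ≡⟨ m≡m%n+[m/n]*n (X u) k ⟩
      X u % k + ρ u * k           ≡⟨ cong₂ (λ a b → a + b * k) (hue-% {c u} {X u} {c v} {X v} hue≡) ρ≡ ⟩
      X v % k + ρ v * k           ≡⟨ sym (m≡m%n+[m/n]*n (X v) k) ⟩
      X v                         ∎
      where open ≡-Reasoning

    conflicts-ρ : ∀ v → conflicts (ρ v) v (X v) ≤ d
    conflicts-ρ v = proj₁ (proj₂ (decided R v (σ-R v)))

    -- If u adopted in an earlier round, v saw its final hue. Otherwise both adopted in the same
    -- round; equal hues then force equal positions, and the clash was counted as an agreement with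
    -- an uncoloured neighbour.
    earlier-clashes : ∀ v p → hueOf (nbr G v p) ≡ hueOf v → X (nbr G v p) ≤ X v → T (clashAt (ρ v) v (X v) p)
    earlier-clashes v p hue≡ Xu≤Xv with ρ (nbr G v p) <? ρ v
    ... | yes ρu<ρv rewrite σ-after (nbr G v p) (<⇒≤ (ρ<R v)) ρu<ρv = ≡⇒≡ᵇ _ _ hue≡
    ... | no  ρu≮ρv rewrite σ-before (nbr G v p) (≮⇒≥ ρu≮ρv) = ≡⇒≡ᵇ _ _
      (trans (cong (value (c (nbr G v p))) (sym Xu≡Xv)) (hue-value {c (nbr G v p)} {X (nbr G v p)} {c v} {X v} hue≡))
      where
      Xu≡Xv : X (nbr G v p) ≡ X v
      Xu≡Xv = same-round hue≡ (≤-antisym (/-monoˡ-≤ k Xu≤Xv) (≮⇒≥ ρu≮ρv))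

    -- Common core of the bounds on outdegree and on the degree inside a part.
    within-conflicts : ∀ v (P : Fin (deg G v) → Bool) →
                       (∀ p → T (P p) → hueOf (nbr G v p) ≡ hueOf v × X (nbr G v p) ≤ X v) →
                       length (filterᵇ P (allFin (deg G v))) ≤ d
    within-conflicts v P earlier = ≤-trans
      (filterᵇ-mono P (clashAt (ρ v) v (X v)) (λ p h → let hue≡ , X≤ = earlier p h in earlier-clashes v p hue≡ X≤) (allFin (deg G v)))
      (conflicts-ρ v)

    color⇒hue : ∀ u v → color algorithm G col R u ≡ color algorithm G col R v → hueOf u ≡ hueOf v
    color⇒hue u v eq = trans (sym (color≡ u)) (trans eq (color≡ v))

    -- Only a neighbour u that adopts in the last round R′ has to be estimated, and then X u ≥ R′ ·
    -- k. If X v < R′ · k, the true and the estimated position both exceed X v. Otherwise v adopts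
    -- in that round too, so equal hues give X u = X v, which is the estimate.
    orient≡ : ∀ v p → hueOf (nbr G v p) ≡ hueOf v →
              orient algorithm G col R v p ≡ precedes (X (nbr G v p)) (c (nbr G v p)) (X v) (c v)
    orient≡ v p hue≡ = at-end R refl
      where
      u = nbr G v p
      late : ∀ {R′} → R ≡ suc R′ → R′ ≤ ρ u →
             precedes (X v ⊔ R′ * k) (c u) (X v) (c v) ≡ precedes (X u) (c u) (X v) (c v)
      late {R′} R≡ R′≤ρu with X v <? R′ * k
      ... | yes Xv<start = trans
              (precedes-> (c u) (c v) (<-≤-trans Xv<start (m≤n⊔m (X v) (R′ * k))))
              (sym (precedes-> (c u) (c v) (<-≤-trans Xv<start
                (≤-trans (*-monoˡ-≤ k R′≤ρu) (m/n*n≤m (X u) k)))))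
      ... | no  Xv≮start = cong (λ x → precedes x (c u) (X v) (c v))
              (trans (m≥n⇒m⊔n≡m (≮⇒≥ Xv≮start)) (sym (same-round hue≡ ρu≡ρv)))
        where
        last : ∀ w → R′ ≤ ρ w → ρ w ≡ R′
        last w R′≤ρw = ≤-antisym (≤-pred (subst (ρ w <_) R≡ (ρ<R w))) R′≤ρw
        ρu≡ρv : ρ u ≡ ρ v
        ρu≡ρv = trans (last u R′≤ρu) (sym (last v
          (subst (_≤ ρ v) (m*n/n≡m R′ k) (/-monoˡ-≤ k (≮⇒≥ Xv≮start)))))
      estimate : ∀ {R′} s → R ≡ suc R′ → σ R′ u ≡ s →
                 orientation (X v) (c v) (R′ * k) s (c u) ≡ precedes (X u) (c u) (X v) (c v)
      estimate {R′} (suc x) R≡ eq = cong (λ x → precedes x (c u) (X v) (c v))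
        (adopted-unique (≤-trans (n≤1+n R′) (≤-reflexive (sym R≡))) eq)
      estimate {R′} zero R≡ eq with ρ u <? R′
      ... | no  ρu≮R′ = late R≡ (≮⇒≥ ρu≮R′)
      ... | yes ρu<R′ = contradiction
              (trans (sym eq) (σ-after u (≤-trans (n≤1+n R′) (≤-reflexive (sym R≡))) ρu<R′)) λ ()
      at-end : ∀ r → R ≡ r → orient algorithm G col R v p ≡ precedes (X u) (c u) (X v) (c v)
      at-end zero    refl = contradiction (ρ<R v) λ ()
      at-end (suc R′) refl = trans
        (trans (cong₂ (λ s x → orientation (pred x) (input S) (pred (round S) * k) s (view S p % m))
                      (message-/ R′ v p) (σ-R v))
        (trans (cong₂ (λ a b → orientation (X v) a (pred b * k) (σ R′ u) (view S p % m))
                      (input-state R v) (round-state R v))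
               (cong (orientation (X v) (c v) (R′ * k) (σ R′ u)) (message-% R′ v p))))
        (estimate (σ R′ u) refl refl)
        where S = state R v

    consistent : OrientationConsistent algorithm G col R
    consistent v p same = begin
      orient algorithm G col R u (back G v p)       ≡⟨ orient≡ u (back G v p) (trans (cong hueOf back≡) (sym hue≡)) ⟩
      precedes (X w) (c w) (X u) (c u)              ≡⟨ cong (λ w → precedes (X w) (c w) (X u) (c u)) back≡ ⟩
      precedes (X v) (c v) (X u) (c u)              ≡⟨ precedes-swap (X u) (c u) (X v) (c v) (λ eq → proper v p (toℕ-injective eq)) ⟩
      not (precedes (X u) (c u) (X v) (c v))        ≡⟨ cong not (sym (orient≡ v p hue≡)) ⟩
      not (orient algorithm G col R v p)            ∎
      where
      open ≡-Reasoning
      u = nbr G v p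
      w = nbr G u (back G v p)
      back≡ : w ≡ v
      back≡ = back-ok G v p
      hue≡ : hueOf u ≡ hueOf v
      hue≡ = color⇒hue u v same

    outdegree-≤ : ∀ v → outdegInClass algorithm G col R v ≤ d
    outdegree-≤ v = within-conflicts v _ λ p h →
      let same , out = Equivalence.to T-∧ h
          hue≡ = color⇒hue (nbr G v p) v (≡ᵇ⇒≡ _ _ same)
      in hue≡ , precedes⇒≤ (X (nbr G v p)) (c (nbr G v p)) (X v) (c v) (subst T (orient≡ v p hue≡) out)

    part-degree-≤ : ∀ v → degInPart algorithm G col R v ≤ d
    part-degree-≤ v = within-conflicts v _ λ p h →
      let same , together = Equivalence.to T-∧ h
          hue≡ = color⇒hue (nbr G v p) v (≡ᵇ⇒≡ _ _ same)
          part≡′ = ≡ᵇ⇒≡ _ _ together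
      in hue≡ , ≤-reflexive (same-round hue≡ (trans (sym (part≡ (nbr G v p))) (trans part≡′ (part≡ v))))

    -- The factor d+1 in the bound on t cancels against the one in `adopted-≤`; injectivity of the
    -- ports bounds the degree by n.
    status-≤ : t ≤ suc d * m → ∀ r v → σ r v ≤ 1 + 2 * (n G * m)
    status-≤ t≤ r v with σ r v in eq
    ... | zero  = z≤n
    ... | suc x = s≤s (*-cancelʳ-≤ x _ (suc d) (begin
      x * suc d                             ≤⟨ adopted-≤ r v eq ⟩
      deg G v * (t + t)                     ≤⟨ *-mono-≤ (injective⇒≤ (nbr-inj G v)) (+-mono-≤ t≤ t≤) ⟩
      n G * (suc d * m + suc d * m)         ≡⟨ lemma (n G) (suc d) m ⟩
      2 * (n G * m) * suc d                 ∎))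
      where
      open ≤-Reasoning
      lemma : ∀ n s m → n * (s * m + s * m) ≡ 2 * (n * m) * s
      lemma = solve-∀

    messages-fit : ∀ a → t ≤ suc d * m → m ≤ n G ^ a →
                   MessagesFit algorithm G col R ((3 + (a + a)) * suc ⌈log₂ n G ⌉)
    messages-fit a t≤ m≤nᵃ r _ v _ = begin-strict
      input (state r v) + σ r v * m         ≡⟨ cong (_+ σ r v * m) (input-state r v) ⟩
      c v + σ r v * m                       <⟨ +-monoˡ-< (σ r v * m) (toℕ<n (col v)) ⟩
      suc (σ r v) * m                       ≤⟨ *-monoˡ-≤ m (s≤s (status-≤ t≤ r v)) ⟩
      (2 + 2 * (n G * m)) * m               ≤⟨ message-≤ a (n G) m {{>-nonZero (≤-<-trans z≤n (toℕ<n v))}} m≤nᵃ ⟩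
      2 ^ ((3 + (a + a)) * suc ⌈log₂ n G ⌉) ∎
      where open ≤-Reasoning

module Parameters (m Δ d k t : ℕ) (1≤m : 1 ≤ m) (d<Δ : suc d < Δ) (log : IsCeilLog Δ d m t)
                  (1≤k : 1 ≤ k) (k≤X : k * suc d ≤ Xnum Δ t) where

  instance
    m≢0 : NonZero m
    m≢0 = >-nonZero 1≤m
    k≢0 : NonZero k
    k≢0 = >-nonZero 1≤k
    t≢0 : NonZero t
    -- t = 0 would make X zero, against 1 ≤ k ≤ X.
    t≢0 = m*n≢0⇒n≢0 (4 * Δ) {{>-nonZero (≤-trans (>-nonZero⁻¹ (k * suc d) {{m*n≢0 k (suc d)}}) k≤X)}}

  open FieldSize (fieldSize {m = m} d<Δ log)

  instance
    q≢0 : NonZero q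
    q≢0 = prime⇒nonZero isPrime

  open Scheme m d k t q public

  R : ℕ
  R = Rounds Δ d t k

  covers : q ≤ R * k
  covers = *-cancelʳ-≤ q (R * k) (suc d) (begin
    q * suc d             ≤⟨ small ⟩
    Xnum Δ t              ≤⟨ cdiv-* (Xnum Δ t) (k * suc d) {{m*n≢0 k (suc d)}} ⟩
    R * (k * suc d)       ≡⟨ sym (*-assoc R k (suc d)) ⟩
    R * k * suc d         ∎)
    where open ≤-Reasoning

  module On (G : Graph) (col : Fin (n G) → Fin m) (maxDeg : MaxDegree≤ G Δ) (proper : Proper G m col) where

    open Analysis isPrime large enough R covers G col maxDeg proper public

    color-< : ∀ v → color algorithm G col R v * suc d < Xnum Δ t * k
    color-< v = begin-strict
      color algorithm G col R v * suc d   ≡⟨ cong (_* suc d) (color≡ v) ⟩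
      hueOf v * suc d                     <⟨ *-monoˡ-< (suc d) (hue-< (c v) (X v)) ⟩
      q * k * suc d                       ≡⟨ lemma q k (suc d) ⟩
      q * suc d * k                       ≤⟨ *-monoˡ-≤ k small ⟩
      Xnum Δ t * k                        ∎
      where
      open ≤-Reasoning
      lemma : ∀ q k s → q * k * s ≡ q * s * k
      lemma = solve-∀

theorem1 : (a : ℕ) → Σ ℕ λ c →
    (m Δ d k t : ℕ) → 1 ≤ m → suc d < Δ → IsCeilLog Δ d m t →
    1 ≤ k → k * suc d ≤ Xnum Δ t →
    Σ (Algorithm m) λ A →
    (G : Graph) (col : Fin (n G) → Fin m) →
    MaxDegree≤ G Δ → Proper G m col → m ≤ n G ^ a →
    let R = Rounds Δ d t k in
    MessagesFit A G col R (c * suc ⌈log₂ n G ⌉)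
    × ((v : Fin (n G)) → color A G col R v * suc d < Xnum Δ t * k)
    × OrientationConsistent A G col R
    × ((v : Fin (n G)) → outdegInClass A G col R v ≤ d)
    × ((v : Fin (n G)) → part A G col R v < R)
    × ((v : Fin (n G)) → degInPart A G col R v ≤ d)
theorem1 a = 3 + (a + a) , λ m Δ d k t 1≤m d<Δ log 1≤k k≤X →
  let module P = Parameters m Δ d k t 1≤m d<Δ log 1≤k k≤X in
  P.algorithm , λ G col maxDeg proper m≤nᵃ →
  let module O = P.On G col maxDeg proper in
  O.messages-fit a (ceilLog-≤ {m = m} d<Δ log) m≤nᵃ
  , O.color-<
  , O.consistent
  , O.outdegree-≤
  , (λ v → subst (_< P.R) (sym (O.part≡ v)) (O.ρ<R v))
  , O.part-degree-≤
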